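{- Let $G=(V,E)$ be a finite graph (parallel edges and loops allowed) and let $e\neq f$ be two edges of $G$. Then, as polynomials in the variables $\{x_g : g\in E\setminus\{e,f\}\}$, \[ \mathcal{M}_{ef}(1) \;=\; \sum_{\beta,\gamma}\Big(\mathbf{x}^{\beta}\mathbf{x}^{\gamma}\sum_{\mathbf{m}\in B_{\beta,\gamma}} \mathbf{m}\Big), \] where the outer sum runs over all ordered pairs $(\beta,\gamma)$ of disjoint subsets of $E\setminus\{e,f\}$.
   Context: Let $\{x_g : g\in E\}$ be variables (positive reals). For $F\subseteq E$ write $\mathbf{x}^F=\prod_{g\in F}x_g$ and let $k(F)$ be the number of connected components of the spanning subgraph $(V,F)$. For $A,B\subseteq E$ set $\mathcal{T}_A^B=\sum_{F\subseteq E:\,A\subseteq F,\,F\cap B=\varnothing}\mathbf{x}^F q^{k(F)}$. Write $\mathcal{T}_e^f=\mathcal{T}_{\{e\}}^{\{f\}}$, $\mathcal{T}_f^e=\mathcal{T}_{\{f\}}^{\{e\}}$, $\mathcal{T}_{ef}=\mathcal{T}_{\{e,f\}}^{\varnothing}$, $\mathcal{T}^{ef}=\mathcal{T}_{\varnothing}^{\{e,f\}}$. The difference $\mathcal{T}_e^f\mathcal{T}_f^e-\mathcal{T}_{ef}\mathcal{T}^{ef}$ is divisible by $x_ex_f(1-q)$, and $\mathcal{M}_{ef}(q):=(\mathcal{T}_e^f\mathcal{T}_f^e-\mathcal{T}_{ef}\mathcal{T}^{ef})/(x_ex_f(1-q))$; $\mathcal{M}_{ef}(1)$ is this polynomial evaluated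 at $q=1$. Let $E^{ef}=E\setminus\{e,f\}$. A subset $F\subseteq E^{ef}$ is a paracel if $e$ and $f$ both join the same two distinct connected components of $(V,F)$; equivalently $(V,F+e)$ and $(V,F+f)$ have the same connected components (as vertex sets) and $k(F+e)=k(F+f)=k(F)-1$. For a paracel $F$, an edge of $E^{ef}\setminus F$ is a smoot for $F$ if it also joins those same two components of $(V,F)$. Given disjoint $\beta,\gamma\subseteq E^{ef}$, a subset $\alpha\subseteq E^{ef}$ is compatible with $\beta,\gamma$ if $\alpha$ is disjoint from $\beta$ and $\gamma$, $\gamma\cup\alpha$ is a paracel, and every edge of $\beta$ is a smoot for $\gamma\cup\alpha$. Let $A_{\beta,\gamma}$ be the set of such $\alpha$. Two elements $\alpha,\alpha'\in A_{\beta,\gamma}$ (possibly equal) are twins if $\alpha\cap\alpha'\in A_{\beta,\gamma}$. $B_{\beta,\gamma}$ is the set (each monomial counted once) of monomials of the form $\mathbf{x}^{\alpha}\mathbf{x}^{\alpha'}$ with $\alpha,\alpha'$ twins in $A_{\beta,\gamma}$. -}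

module Defs where

open import Data.Bool.Base using (if_then_else_)
open import Data.Fin.Base using (Fin; zero; suc)
import Data.Fin.Properties as Fin
open import Data.Fin.Subset
  using (Subset; inside; outside; _∈_; _∉_; _⊆_; _∪_; _∩_; ∁; ⁅_⁆; ⊥; Empty; Lift)
open import Data.Fin.Subset.Properties using (_∈?_; _⊆?_; nonempty?; Lift?)
open import Data.Integer.Base as ℤ using (ℤ; 0ℤ; 1ℤ)
open import Data.List.Base
  using (List; []; _∷_; [_]; _++_; concatMap; map; filter; length; deduplicate; allFin; cartesianProduct)
open import Data.Nat.Base as ℕ using (ℕ; zero; suc)
import Data.Nat.Properties as ℕ
open import Data.Product.Base using (_×_; _,_; proj₁; proj₂; ∃-syntax; uncurry; map₂)
open import Data.Sum.Base using (_⊎_; inj₁; inj₂)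
open import Data.Vec.Base as Vec using (Vec; []; _∷_; here; there)
open import Data.Vec.Properties using (≡-dec)
open import Function.Base using (_∘_)
open import Relation.Binary.Construct.Closure.Equivalence using (EqClosure)
open import Relation.Binary.Construct.Closure.ReflexiveTransitive
  using (ε; _◅_; _◅◅_; gmap)
open import Relation.Binary.Construct.Closure.Symmetric as Sym using (fwd; bwd)
open import Relation.Binary.PropositionalEquality using (_≡_; refl)
open import Relation.Nullary using (Dec; yes; no; ¬_; ¬?; does; _×-dec_; _⊎-dec_)
open import Relation.Nullary.Decidable using (map′)
open import Relation.Unary using (Decidable)

infixl 6 _+ᴾ_ _-ᴾ_
infixl 7 _*ᴾ_
infix  4 _≈ᴾ_

-- ℤ[x₀,…,xₙ₋₁]: a polynomial is a finite list of terms (coefficient ,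
-- exponent vector), in which an exponent vector may be repeated or carry the
-- coefficient 0.  Hence polynomials are compared by _≈ᴾ_, never by _≡_.

Mon : ℕ → Set
Mon n = Vec ℕ n

Poly : ℕ → Set
Poly n = List (ℤ × Mon n)

_≟ᴹ_ : ∀ {n} (a b : Mon n) → Dec (a ≡ b)
_≟ᴹ_ = ≡-dec ℕ._≟_

_*ᴹ_ : ∀ {n} → Mon n → Mon n → Mon n
_*ᴹ_ = Vec.zipWith ℕ._+_

coeff : ∀ {n} → Poly n → Mon n → ℤ
coeff []            a = 0ℤ
coeff ((c , b) ∷ p) a = (if does (b ≟ᴹ a) then c else 0ℤ) ℤ.+ coeff p a

_≈ᴾ_ : ∀ {n} → Poly n → Poly n → Set
p ≈ᴾ r = ∀ a → coeff p a ≡ coeff r a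

mono : ∀ {n} → Mon n → Poly n
mono a = [ (1ℤ , a) ]

1ᴾ : ∀ {n} → Poly n
1ᴾ = mono (Vec.replicate _ 0)

_+ᴾ_ : ∀ {n} → Poly n → Poly n → Poly n
_+ᴾ_ = _++_

_-ᴾ_ : ∀ {n} → Poly n → Poly n → Poly n
p -ᴾ r = p ++ map (λ (c , a) → (ℤ.- c , a)) r

_*ᴾ_ : ∀ {n} → Poly n → Poly n → Poly n
p *ᴾ r = concatMap (λ (c , a) → map (λ (d , b) → (c ℤ.* d , a *ᴹ b)) r) p

∑ : ∀ {A : Set} {n} → List A → (A → Poly n) → Poly n
∑ xs p = concatMap p xs

-- The exponent vector of 𝐱^F = ∏_{g ∈ F} x_g.
𝐱^_ : ∀ {m} → Subset m → Mon m
𝐱^ F = Vec.map (λ s → if s then 1 else 0) F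

-- Poly (suc m) serves as ℤ[q , x_g : g ∈ Fin m]; the exponent of q comes first.

𝐪 : ∀ {m} → Poly (suc m)
𝐪 = mono (1 ∷ Vec.replicate _ 0)

𝐱 : ∀ {m} → Fin m → Poly (suc m)
𝐱 g = mono (0 ∷ 𝐱^ ⁅ g ⁆)

at-q=1 : ∀ {m} → Poly (suc m) → Poly m
at-q=1 = map (map₂ Vec.tail)

subsets : ∀ m → List (Subset m)
subsets zero    = [ [] ]
subsets (suc m) = map (outside ∷_) (subsets m) ++ map (inside ∷_) (subsets m)

-- Loops and parallel edges are allowed; the order of the two ends of an edge
-- plays no role, since connectivity below uses the symmetric closure.
record Graph (n m : ℕ) : Set where
  field
    ends : Fin m → Fin n × Fin n

module _ {n : ℕ} where

  Link : ∀ {m} → (Fin m → Fin n × Fin n) → Subset m → Fin n → Fin n → Set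
  Link ends F u v = ∃[ g ] g ∈ F × ends g ≡ (u , v)

  Conn : ∀ {m} → (Fin m → Fin n × Fin n) → Subset m → Fin n → Fin n → Set
  Conn ends F = EqClosure (Link ends F)

  private
    module _ {m : ℕ} (ends : Fin (suc m) → Fin n × Fin n) (F : Subset m) where

      Tail = Conn (ends ∘ suc) F

      weaken : ∀ s {u v} → Tail u v → Conn ends (s ∷ F) u v
      weaken s = gmap _ (Sym.map λ (g , g∈F , eq) → suc g , there g∈F , eq)

      strengthen : ∀ {u v} → Conn ends (outside ∷ F) u v → Tail u v
      strengthen = gmap _ (Sym.map λ { (suc g , there g∈F , eq) → g , g∈F , eq })

      a = proj₁ (ends zero)
      b = proj₂ (ends zero)

      Via : Fin n → Fin n → Set
      Via u v = Tail u v ⊎ (Tail u a × Tail b v) ⊎ (Tail u b × Tail a v)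

      fromVia : ∀ {u v} → Via u v → Conn ends (inside ∷ F) u v
      fromVia (inj₁ p)              = weaken _ p
      fromVia (inj₂ (inj₁ (p , r))) =
        weaken _ p ◅◅ fwd (zero , here , refl) ◅ weaken _ r
      fromVia (inj₂ (inj₂ (p , r))) =
        weaken _ p ◅◅ bwd (zero , here , refl) ◅ weaken _ r

      prepend : ∀ {u w v} → Tail u w → Via w v → Via u v
      prepend t (inj₁ p)              = inj₁ (t ◅◅ p)
      prepend t (inj₂ (inj₁ (p , r))) = inj₂ (inj₁ (t ◅◅ p , r))
      prepend t (inj₂ (inj₂ (p , r))) = inj₂ (inj₂ (t ◅◅ p , r))

      toVia : ∀ {u v} → Conn ends (inside ∷ F) u v → Via u v
      toVia ε = inj₁ ε
      toVia (fwd (suc g , there g∈F , eq) ◅ p) =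
        prepend (fwd (g , g∈F , eq) ◅ ε) (toVia p)
      toVia (bwd (suc g , there g∈F , eq) ◅ p) =
        prepend (bwd (g , g∈F , eq) ◅ ε) (toVia p)
      toVia (fwd (zero , here , refl) ◅ p) with toVia p
      ... | inj₁ r              = inj₂ (inj₁ (ε , r))
      ... | inj₂ (inj₁ (_ , r)) = inj₂ (inj₁ (ε , r))
      ... | inj₂ (inj₂ (_ , r)) = inj₁ r
      toVia (bwd (zero , here , refl) ◅ p) with toVia p
      ... | inj₁ r              = inj₂ (inj₂ (ε , r))
      ... | inj₂ (inj₁ (_ , r)) = inj₁ r
      ... | inj₂ (inj₂ (_ , r)) = inj₂ (inj₂ (ε , r))

  conn? : ∀ {m} (ends : Fin m → Fin n × Fin n) F u v → Dec (Conn ends F u v)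
  conn? ends [] u v = map′ (λ { refl → ε }) empty (u Fin.≟ v)
    where
    empty : ∀ {u v} → Conn ends [] u v → u ≡ v
    empty ε                  = refl
    empty (fwd (() , _) ◅ _)
    empty (bwd (() , _) ◅ _)
  conn? ends (outside ∷ F) u v =
    map′ (weaken ends F outside) (strengthen ends F) (conn? (ends ∘ suc) F u v)
  conn? ends (inside ∷ F) u v =
    map′ (fromVia ends F) (toVia ends F)
      (c? u v ⊎-dec (c? u a′ ×-dec c? b′ v) ⊎-dec (c? u b′ ×-dec c? a′ v))
    where
    c? = conn? (ends ∘ suc) F
    a′ = proj₁ (ends zero)
    b′ = proj₂ (ends zero)

module _ {n m : ℕ} (G : Graph n m) where

  open Graph G

  -- deduplicate keeps exactly one vertex of every component of (V , F).
  k : Subset m → ℕ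
  k F = length (deduplicate (conn? ends F) (allFin n))

  𝒯 : Subset m → Subset m → Poly (suc m)
  𝒯 A B = ∑ (filter (λ F → (A ⊆? F) ×-dec ¬? (nonempty? (F ∩ B))) (subsets m))
            (λ F → mono (k F ∷ 𝐱^ F))

  -- Edge g joins the component of u to the component of v in (V , F).
  Joins : Subset m → Fin n → Fin n → Fin m → Set
  Joins F u v g = (Conn ends F (proj₁ (ends g)) u × Conn ends F (proj₂ (ends g)) v)
                ⊎ (Conn ends F (proj₁ (ends g)) v × Conn ends F (proj₂ (ends g)) u)

  joins? : ∀ F u v → Decidable (Joins F u v)
  joins? F u v g = (c? (proj₁ (ends g)) u ×-dec c? (proj₂ (ends g)) v)
             ⊎-dec (c? (proj₁ (ends g)) v ×-dec c? (proj₂ (ends g)) u)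
    where c? = conn? ends F

  module _ (e f : Fin m) where

    -- ℳ = (𝒯_e^f 𝒯_f^e − 𝒯_{ef} 𝒯^{ef}) / (x_e x_f (1 − q)); the quotient is
    -- unique up to _≈ᴾ_ because the polynomial ring is an integral domain.
    Isℳ : Poly (suc m) → Set
    Isℳ ℳ = 𝐱 e *ᴾ 𝐱 f *ᴾ (1ᴾ -ᴾ 𝐪) *ᴾ ℳ
          ≈ᴾ 𝒯 ⁅ e ⁆ ⁅ f ⁆ *ᴾ 𝒯 ⁅ f ⁆ ⁅ e ⁆
             -ᴾ 𝒯 (⁅ e ⁆ ∪ ⁅ f ⁆) ⊥ *ᴾ 𝒯 ⊥ (⁅ e ⁆ ∪ ⁅ f ⁆)

    Eᵉᶠ : Subset m
    Eᵉᶠ = ∁ (⁅ e ⁆ ∪ ⁅ f ⁆)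

    Paracel : Subset m → Set
    Paracel F = F ⊆ Eᵉᶠ × (∃[ u ] ∃[ v ] ¬ Conn ends F u v × Joins F u v e × Joins F u v f)

    Smoot : Subset m → Fin m → Set
    Smoot F g = g ∈ Eᵉᶠ × g ∉ F ×
      (∃[ u ] ∃[ v ] ¬ Conn ends F u v × Joins F u v e × Joins F u v f × Joins F u v g)

    -- α ∈ A_{β,γ}
    Compatible : (β γ α : Subset m) → Set
    Compatible β γ α =
      α ⊆ Eᵉᶠ × Empty (α ∩ β) × Empty (α ∩ γ) × Paracel (γ ∪ α) × Lift (Smoot (γ ∪ α)) β

    Twins : (β γ α α′ : Subset m) → Set
    Twins β γ α α′ = Compatible β γ α × Compatible β γ α′ × Compatible β γ (α ∩ α′)

    paracel? : Decidable Paracel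
    paracel? F = (F ⊆? Eᵉᶠ) ×-dec Fin.any? λ u → Fin.any? λ v →
      ¬? (conn? ends F u v) ×-dec joins? F u v e ×-dec joins? F u v f

    smoot? : ∀ F → Decidable (Smoot F)
    smoot? F g = (g ∈? Eᵉᶠ) ×-dec ¬? (g ∈? F) ×-dec Fin.any? λ u → Fin.any? λ v →
      ¬? (conn? ends F u v) ×-dec joins? F u v e ×-dec joins? F u v f ×-dec joins? F u v g

    compatible? : ∀ β γ → Decidable (Compatible β γ)
    compatible? β γ α =
      (α ⊆? Eᵉᶠ) ×-dec ¬? (nonempty? (α ∩ β)) ×-dec ¬? (nonempty? (α ∩ γ))
      ×-dec paracel? (γ ∪ α) ×-dec Lift? (smoot? (γ ∪ α)) β

    twins? : ∀ β γ → Decidable (uncurry (Twins β γ))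
    twins? β γ (α , α′) =
      compatible? β γ α ×-dec compatible? β γ α′ ×-dec compatible? β γ (α ∩ α′)

    -- B_{β,γ}, listed without repetition.
    twinMonomials : (β γ : Subset m) → List (Mon m)
    twinMonomials β γ = deduplicate _≟ᴹ_
      (map (λ (α , α′) → (𝐱^ α) *ᴹ (𝐱^ α′))
        (filter (twins? β γ) (cartesianProduct (subsets m) (subsets m))))

    disjointPairs : List (Subset m × Subset m)
    disjointPairs =
      filter (λ (β , γ) → (β ⊆? Eᵉᶠ) ×-dec (γ ⊆? Eᵉᶠ) ×-dec ¬? (nonempty? (β ∩ γ)))
        (cartesianProduct (subsets m) (subsets m))

{-# OPTIONS --safe #-}
-- For F , F′ ⊆ E ─ {e , f} the terms of 𝒯_e^f 𝒯_f^e − 𝒯_{ef} 𝒯^{ef} pair up to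
-- x_e x_f 𝐱^F 𝐱^F′ (q^A − q^B), where A = k(F+e) + k(F′+f) and B = k(F+e+f) + k(F′).
-- Since (q^A − q^B) / (1 − q) takes the value B − A at q = 1, and F and F′ may be
-- exchanged, ℳ(1) = ∑ (k(F+e+f) + k(F) − k(F+e) − k(F+f)) 𝐱^F 𝐱^F′, and the
-- coefficient is 1 if F is a paracel and 0 otherwise.
--
-- A pair (F paracel , F′) is then encoded by γ = F ─ F′, by the set β of the smoots of
-- F in F′, and by 𝐦 = 𝐱^(F ∩ F′) 𝐱^(F′ ─ β).  This is a bijection onto the triples
-- (β , γ , 𝐦) of the theorem: β and γ determine F and F′ from the exponents of 𝐦, and
-- 𝐦 is a twin monomial because the edges of F′ ─ F that are not smoots can be divided
-- into those touching the component of one end of e and the others, neither part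
-- connecting the ends of e.
module Submission where

open import Defs
open import Data.Bool.Base using (true; false; if_then_else_)
open import Data.Fin.Base using (Fin; zero; suc)
import Data.Fin.Properties as Fin
open import Data.Fin.Subset as Subset
  using (Subset; inside; outside; _⊆_; _∪_; _∩_; ∁; ⁅_⁆; ⊥; Empty)
open import Data.Fin.Subset.Properties
  using ( _∈?_; _⊆?_; nonempty?; ⊆-antisym; Empty-unique; ∉⊥; x∈⁅x⁆; x∈⁅y⁆⇒x≡y
        ; x∈∁p⇒x∉p; x∉p⇒x∈∁p; x∈p∩q⁺; x∈p∩q⁻; x∈p∪q⁺; x∈p∪q⁻; p∩q⊆p; p∩q⊆q
        ; p⊆p∪q; q⊆p∪q; ∩-comm; ∪-comm; ∪-assoc; ∪-identityˡ; ∪-identityʳ)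
open import Data.Integer.Base as ℤ using (ℤ; 0ℤ; 1ℤ; _+_; _-_; _*_; -_)
import Data.Integer.Properties as ℤ
open import Data.Integer.Tactic.RingSolver using (solve-∀)
open import Data.List.Base
  using ( List; []; _∷_; _++_; concatMap; map; filter; length; lookup; deduplicate
        ; allFin; cartesianProduct)
open import Data.List.Membership.Propositional using (_∈_; find; lose)
open import Data.List.Membership.Propositional.Properties
  using ( ∈-map⁺; ∈-map⁻; ∈-++⁺ˡ; ∈-++⁺ʳ; ∈-++⁻; ∈-concatMap⁺; ∈-filter⁺; ∈-filter⁻
        ; ∈-allFin; ∈-lookup; ∈-cartesianProduct⁺; ∈-cartesianProduct⁻
        ; ∈-deduplicate⁺; ∈-deduplicate⁻)
open import Data.List.Membership.Propositional.Properties.WithK using (unique∧set⇒bag)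
open import Data.List.Properties using (length-filter)
open import Data.List.Relation.Binary.BagAndSetEquality using (∼bag⇒↭)
open import Data.List.Relation.Binary.Permutation.Propositional as ↭ using (_↭_)
import Data.List.Relation.Unary.All as All
import Data.List.Relation.Unary.All.Properties as All
open import Data.List.Relation.Unary.AllPairs as AllPairs using (AllPairs; []; _∷_)
open import Data.List.Relation.Unary.Any as Any using (Any; here; there)
open import Data.List.Relation.Unary.Any.Properties using (lookup-index; deduplicate⁺)
import Data.List.Relation.Unary.Unique.DecPropositional.Properties as DecPropositional
import Data.List.Relation.Unary.Unique.DecSetoid.Properties as DecSetoid
open import Data.List.Relation.Unary.Unique.Propositional using (Unique)
import Data.List.Relation.Unary.Unique.Propositional.Properties as Unique
open import Data.Nat.Base as ℕ using (ℕ; zero; suc; _∸_; _≤_; _≤ᵇ_; s≤s)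
import Data.Nat.Properties as ℕ
open import Data.Product.Base using (_×_; _,_; proj₁; proj₂; ∃-syntax)
open import Data.Sum.Base as Sum using (_⊎_; inj₁; inj₂; [_,_]′)
open import Data.Vec.Base as Vec using ([]; _∷_)
open import Data.Vec.Properties
  using (lookup⇒[]=; []=⇒lookup; lookup∘tabulate; zipWith-comm; zipWith-assoc; zipWith-identityˡ)
open import Function.Base using (_∘_)
open import Function.Bundles using (mk⇔)
open import Relation.Binary.Bundles using (DecSetoid)
open import Relation.Binary.Construct.Closure.Equivalence as EqClosure
  using (symmetric; isEquivalence)
open import Relation.Binary.Construct.Closure.ReflexiveTransitive using (ε; _◅_; _◅◅_)
open import Relation.Binary.Construct.Closure.Symmetric using (fwd; bwd)
open import Relation.Binary.PropositionalEquality
  using (_≡_; _≢_; refl; sym; trans; cong; cong₂; subst; module ≡-Reasoning)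
open import Relation.Binary.Structures using (IsEquivalence)
open import Relation.Nullary
  using (yes; no; does; ¬_; ¬?; contradiction; _×-dec_; _⊎-dec_)
open import Relation.Nullary.Decidable using (dec-true; dec-false)
open import Relation.Unary using (Decidable)

private variable
  A B : Set

-- Finite sums of integers

infixr 5 ∑ᶻ
syntax ∑ᶻ xs (λ x → h) = ∑[ x ← xs ] h

∑ᶻ : List A → (A → ℤ) → ℤ
∑ᶻ []       h = 0ℤ
∑ᶻ (x ∷ xs) h = h x + ∑ᶻ xs h

∑ᶻ-cong-∈ : ∀ (xs : List A) {h h′} → (∀ {x} → x ∈ xs → h x ≡ h′ x) → ∑ᶻ xs h ≡ ∑ᶻ xs h′
∑ᶻ-cong-∈ []       eq = refl
∑ᶻ-cong-∈ (x ∷ xs) eq = cong₂ _+_ (eq (here refl)) (∑ᶻ-cong-∈ xs (eq ∘ there))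

∑ᶻ-cong : ∀ (xs : List A) {h h′} → (∀ x → h x ≡ h′ x) → ∑ᶻ xs h ≡ ∑ᶻ xs h′
∑ᶻ-cong xs eq = ∑ᶻ-cong-∈ xs (λ {x} _ → eq x)

∑ᶻ-++ : ∀ (xs : List A) {ys h} → ∑ᶻ (xs ++ ys) h ≡ ∑ᶻ xs h + ∑ᶻ ys h
∑ᶻ-++ []                = sym (ℤ.+-identityˡ _)
∑ᶻ-++ (x ∷ xs) {_} {h} = trans (cong (h x +_) (∑ᶻ-++ xs)) (sym (ℤ.+-assoc (h x) _ _))

∑ᶻ-map : ∀ (f : A → B) xs {h} → ∑ᶻ (map f xs) h ≡ ∑ᶻ xs (h ∘ f)
∑ᶻ-map f []           = refl
∑ᶻ-map f (x ∷ xs) {h} = cong (h (f x) +_) (∑ᶻ-map f xs)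

∑ᶻ-concatMap : ∀ (g : A → List B) xs {h} →
               ∑ᶻ (concatMap g xs) h ≡ ∑[ x ← xs ] ∑ᶻ (g x) h
∑ᶻ-concatMap g []           = refl
∑ᶻ-concatMap g (x ∷ xs) {h} =
  trans (∑ᶻ-++ (g x)) (cong (∑ᶻ (g x) h +_) (∑ᶻ-concatMap g xs))

∑ᶻ-zero : ∀ (xs : List A) → ∑[ x ← xs ] 0ℤ ≡ 0ℤ
∑ᶻ-zero []       = refl
∑ᶻ-zero (x ∷ xs) = trans (ℤ.+-identityˡ _) (∑ᶻ-zero xs)

∑ᶻ-+ : ∀ (xs : List A) {h h′} → ∑[ x ← xs ] (h x + h′ x) ≡ ∑ᶻ xs h + ∑ᶻ xs h′
∑ᶻ-+ []                  = refl
∑ᶻ-+ (x ∷ xs) {h} {h′} =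
  trans (cong (h x + h′ x +_) (∑ᶻ-+ xs)) (interchange (h x) (h′ x) _ _)
  where
  interchange : ∀ i j k l → i + j + (k + l) ≡ i + k + (j + l)
  interchange = solve-∀

∑ᶻ-*ˡ : ∀ (xs : List A) {h} c → ∑[ x ← xs ] (c * h x) ≡ c * ∑ᶻ xs h
∑ᶻ-*ˡ []           c = sym (ℤ.*-zeroʳ c)
∑ᶻ-*ˡ (x ∷ xs) {h} c =
  trans (cong (c * h x +_) (∑ᶻ-*ˡ xs c)) (sym (ℤ.*-distribˡ-+ c (h x) _))

∑ᶻ-neg : ∀ (xs : List A) {h} → ∑[ x ← xs ] (- h x) ≡ - ∑ᶻ xs h
∑ᶻ-neg []           = refl
∑ᶻ-neg (x ∷ xs) {h} = trans (cong (- h x +_) (∑ᶻ-neg xs)) (sym (ℤ.neg-distrib-+ (h x) _))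

∑ᶻ-- : ∀ (xs : List A) {h h′} → ∑[ x ← xs ] (h x - h′ x) ≡ ∑ᶻ xs h - ∑ᶻ xs h′
∑ᶻ-- xs {h} {h′} = trans (∑ᶻ-+ xs {h} {λ x → - h′ x}) (cong (∑ᶻ xs h +_) (∑ᶻ-neg xs {h′}))

∑ᶻ-swap : ∀ (xs : List A) (ys : List B) {h : A → B → ℤ} →
          ∑[ x ← xs ] ∑[ y ← ys ] h x y ≡ ∑[ y ← ys ] ∑[ x ← xs ] h x y
∑ᶻ-swap []       ys     = sym (∑ᶻ-zero ys)
∑ᶻ-swap (x ∷ xs) ys {h} =
  trans (cong (∑ᶻ ys (h x) +_) (∑ᶻ-swap xs ys)) (sym (∑ᶻ-+ ys))

∑ᶻ-filter : ∀ {P : A → Set} (P? : Decidable P) xs {h} →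
            ∑ᶻ (filter P? xs) h ≡ ∑[ x ← xs ] (if does (P? x) then h x else 0ℤ)
∑ᶻ-filter P? []           = refl
∑ᶻ-filter P? (x ∷ xs) {h} with P? x
... | yes _ = cong (h x +_) (∑ᶻ-filter P? xs)
... | no  _ = trans (∑ᶻ-filter P? xs) (sym (ℤ.+-identityˡ _))

∑ᶻ-cartesianProduct : ∀ (xs : List A) (ys : List B) {h} →
                      ∑ᶻ (cartesianProduct xs ys) h ≡ ∑[ x ← xs ] ∑[ y ← ys ] h (x , y)
∑ᶻ-cartesianProduct []       ys     = refl
∑ᶻ-cartesianProduct (x ∷ xs) ys {h} =
  trans (∑ᶻ-++ (map (x ,_) ys)) (cong₂ _+_ (∑ᶻ-map (x ,_) ys) (∑ᶻ-cartesianProduct xs ys))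

∑ᶻ-↭ : ∀ {xs ys : List A} {h} → xs ↭ ys → ∑ᶻ xs h ≡ ∑ᶻ ys h
∑ᶻ-↭ ↭.refl                  = refl
∑ᶻ-↭ {h = h} (↭.prep x p)    = cong (h x +_) (∑ᶻ-↭ p)
∑ᶻ-↭ {h = h} (↭.swap x y p)  =
  trans (cong (λ s → h x + (h y + s)) (∑ᶻ-↭ p)) (exchange (h x) (h y) _)
  where
  exchange : ∀ i j k → i + (j + k) ≡ j + (i + k)
  exchange = solve-∀
∑ᶻ-↭ (↭.trans p q)           = trans (∑ᶻ-↭ p) (∑ᶻ-↭ q)

-- Injectivity is asked only on members: a map such as `_∩ ∁ A` is in general injective only on the
-- sets that contain `A`.
Unique-map-∈ : ∀ (f : A → B) {xs} → (∀ {x y} → x ∈ xs → y ∈ xs → f x ≡ f y → x ≡ y) →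
               Unique xs → Unique (map f xs)
Unique-map-∈ f inj []         = []
Unique-map-∈ f inj (x∉ ∷ uniq) =
  All.map⁺ (All.tabulate λ y∈ eq →
    All.lookup x∉ y∈ (inj (here refl) (there y∈) eq))
  ∷ Unique-map-∈ f (λ x∈ y∈ → inj (there x∈) (there y∈)) uniq

-- `map f xs` and `ys` are duplicate-free lists with the same members, hence permutations of each
-- other.
∑ᶻ-reindex : ∀ {xs : List A} {ys : List B} {h h′} (f : A → B) (g : B → A) →
             Unique xs → Unique ys →
             (∀ {x} → x ∈ xs → f x ∈ ys × g (f x) ≡ x) →
             (∀ {y} → y ∈ ys → g y ∈ xs × f (g y) ≡ y) →
             (∀ {x} → x ∈ xs → h x ≡ h′ (f x)) →
             ∑ᶻ xs h ≡ ∑ᶻ ys h′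
∑ᶻ-reindex {xs = xs} {ys} {h} {h′} f g xs! ys! to from eq = begin
  ∑ᶻ xs h            ≡⟨ ∑ᶻ-cong-∈ xs eq ⟩
  ∑ᶻ xs (h′ ∘ f)     ≡⟨ ∑ᶻ-map f xs ⟨
  ∑ᶻ (map f xs) h′   ≡⟨ ∑ᶻ-↭ (∼bag⇒↭ (unique∧set⇒bag map! ys! (mk⇔ into onto))) ⟩
  ∑ᶻ ys h′           ∎
  where
  open ≡-Reasoning
  map! = Unique-map-∈ f
    (λ x∈ y∈ fx≡fy → trans (sym (proj₂ (to x∈))) (trans (cong g fx≡fy) (proj₂ (to y∈)))) xs!
  into : ∀ {y} → y ∈ map f xs → y ∈ ys
  into y∈ with _ , x∈ , refl ← ∈-map⁻ f y∈ = proj₁ (to x∈)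
  onto : ∀ {y} → y ∈ ys → y ∈ map f xs
  onto {y} y∈ with g y | f (g y) | from y∈ | ∈-map⁺ f (proj₁ (from y∈))
  ... | _ | _ | _ , refl | fgy∈ = fgy∈

dependentPairs : List A → (A → List B) → List (A × B)
dependentPairs xs g = concatMap (λ x → map (x ,_) (g x)) xs

∈-dependentPairs⁺ : ∀ {xs : List A} {g : A → List B} {x y} →
                    x ∈ xs → y ∈ g x → (x , y) ∈ dependentPairs xs g
∈-dependentPairs⁺ {g = g} {x} x∈ y∈ =
  ∈-concatMap⁺ (λ x → map (x ,_) (g x)) (Any.map (λ { refl → ∈-map⁺ (x ,_) y∈ }) x∈)

∈-dependentPairs⁻ : ∀ (xs : List A) {g : A → List B} {x y} →
                    (x , y) ∈ dependentPairs xs g → x ∈ xs × y ∈ g x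
∈-dependentPairs⁻ (z ∷ xs) {g} xy∈ with ∈-++⁻ (map (z ,_) (g z)) xy∈
... | inj₁ xy∈ˡ with _ , y∈ , refl ← ∈-map⁻ (z ,_) xy∈ˡ = here refl , y∈
... | inj₂ xy∈ʳ with x∈ , y∈ ← ∈-dependentPairs⁻ xs xy∈ʳ = there x∈ , y∈

dependentPairs-! : ∀ {xs : List A} {g : A → List B} →
                   Unique xs → (∀ x → Unique (g x)) → Unique (dependentPairs xs g)
dependentPairs-! []                       g! = []
dependentPairs-! {xs = x ∷ xs} {g} x∷xs!@(_ ∷ xs!) g! =
  Unique.++⁺ (Unique.map⁺ (λ { refl → refl }) (g! x)) (dependentPairs-! xs! g!) disjoint
  where
  disjoint : ∀ {p} → ¬ (p ∈ map (x ,_) (g x) × p ∈ dependentPairs xs g)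
  disjoint (p∈ˡ , p∈ʳ) with _ , _ , refl ← ∈-map⁻ (x ,_) p∈ˡ =
    Unique.Unique[x∷xs]⇒x∉xs x∷xs! (proj₁ (∈-dependentPairs⁻ xs p∈ʳ))

∑ᶻ-dependentPairs : ∀ (xs : List A) {g : A → List B} {h} →
                    ∑ᶻ (dependentPairs xs g) h ≡ ∑[ x ← xs ] ∑[ y ← g x ] h (x , y)
∑ᶻ-dependentPairs xs {g} =
  trans (∑ᶻ-concatMap (λ x → map (x ,_) (g x)) xs) (∑ᶻ-cong xs λ x → ∑ᶻ-map (x ,_) (g x))

private variable
  n : ℕ

-- Polynomials as linear functionals

-- The ℤ-linear extension of φ from monomials to polynomials.
eval : Poly n → (Mon n → ℤ) → ℤ
eval p φ = ∑[ (c , a) ← p ] (c * φ a)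

δ : Mon n → Mon n → ℤ
δ a b = if does (b ≟ᴹ a) then 1ℤ else 0ℤ

eval-cong : ∀ (p : Poly n) {φ ψ} → (∀ a → φ a ≡ ψ a) → eval p φ ≡ eval p ψ
eval-cong p eq = ∑ᶻ-cong p λ (c , a) → cong (c *_) (eq a)

coeff≡eval : ∀ (p : Poly n) a → coeff p a ≡ eval p (δ a)
coeff≡eval []            a = refl
coeff≡eval ((c , b) ∷ p) a = cong₂ _+_ lead (coeff≡eval p a)
  where
  lead : (if does (b ≟ᴹ a) then c else 0ℤ) ≡ c * δ a b
  lead with b ≟ᴹ a
  ... | yes _ = sym (ℤ.*-identityʳ c)
  ... | no  _ = sym (ℤ.*-zeroʳ c)

-- A coefficient is itself a functional, the one given by `δ a`. Polynomial identities are therefore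
-- proved by evaluating both sides at an arbitrary `φ`, without normalising lists of terms.
eval⇒≈ᴾ : ∀ {p r : Poly n} → (∀ φ → eval p φ ≡ eval r φ) → p ≈ᴾ r
eval⇒≈ᴾ {p = p} {r} eq a = trans (coeff≡eval p a) (trans (eq (δ a)) (sym (coeff≡eval r a)))

without : Mon n → Poly n → Poly n
without b = filter (λ (_ , a) → ¬? (a ≟ᴹ b))

eval-without : ∀ b (p : Poly n) φ → eval p φ ≡ coeff p b * φ b + eval (without b p) φ
eval-without b []            φ = refl
eval-without b ((c , a) ∷ p) φ with a ≟ᴹ b
... | yes refl = trans (cong (c * φ b +_) (eval-without b p φ)) (collect c (φ b) _ _)
  where
  collect : ∀ c x d r → c * x + (d * x + r) ≡ (c + d) * x + r
  collect = solve-∀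
... | no  _    = trans (cong (c * φ a +_) (eval-without b p φ))
                       (collect (c * φ a) (φ b) (coeff p b) (eval (without b p) φ))
  where
  collect : ∀ y x d r → y + (d * x + r) ≡ (0ℤ + d) * x + (y + r)
  collect = solve-∀

coeff-without : ∀ b (p : Poly n) → p ≈ᴾ [] → without b p ≈ᴾ []
coeff-without b p p≈0 a = begin
  coeff (without b p) a                     ≡⟨ coeff≡eval (without b p) a ⟩
  eval (without b p) (δ a)                  ≡⟨ ℤ.+-identityˡ _ ⟨
  0ℤ * δ a b + eval (without b p) (δ a)
    ≡⟨ cong (λ c → c * δ a b + eval (without b p) (δ a)) (p≈0 b) ⟨
  coeff p b * δ a b + eval (without b p) (δ a)  ≡⟨ eval-without b p (δ a) ⟨
  eval p (δ a)                              ≡⟨ coeff≡eval p a ⟨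
  coeff p a                                 ≡⟨ p≈0 a ⟩
  0ℤ                                        ∎
  where open ≡-Reasoning

-- Cancellation may involve terms far apart in the list, so one whole monomial is removed at a time:
-- the terms in `b` together contribute `coeff p b * φ b`, which is 0, and the rest still has zero
-- coefficients. The rest is not a subterm of the list, hence the induction on a bound for the
-- length.
eval-≈0 : ∀ (p : Poly n) φ → p ≈ᴾ [] → eval p φ ≡ 0ℤ
eval-≈0 p φ = go (length p) p ℕ.≤-refl
  where
  open ≡-Reasoning
  go : ∀ N p → length p ≤ N → p ≈ᴾ [] → eval p φ ≡ 0ℤ
  go N       []              _         _   = refl
  go (suc N) p@((c , b) ∷ t) (s≤s t≤N) p≈0 = begin
    eval p φ                                ≡⟨ eval-without b p φ ⟩
    coeff p b * φ b + eval (without b p) φ  ≡⟨ cong (λ d → d * φ b + eval (without b p) φ) (p≈0 b) ⟩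
    0ℤ + eval (without b p) φ               ≡⟨ ℤ.+-identityˡ _ ⟩
    eval (without b p) φ                    ≡⟨ go N (without b p) shorter (coeff-without b p p≈0) ⟩
    0ℤ                                      ∎
    where
    -- The leading term has monomial `b` and is itself removed, so the length drops.
    shorter : length (without b p) ≤ N
    shorter with b ≟ᴹ b
    ... | yes _   = ℕ.≤-trans (length-filter (λ (_ , a) → ¬? (a ≟ᴹ b)) t) t≤N
    ... | no  b≢b = contradiction refl b≢b

eval-neg : ∀ (p : Poly n) {φ} → eval p (λ a → - φ a) ≡ - eval p φ
eval-neg p {φ} =
  trans (∑ᶻ-cong p λ (c , a) → sym (ℤ.neg-distribʳ-* c (φ a))) (∑ᶻ-neg p)

eval-- : ∀ (p : Poly n) {r φ} → eval (p -ᴾ r) φ ≡ eval p φ - eval r φ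
eval-- p {r} {φ} = trans (∑ᶻ-++ p) (cong (eval p φ +_) (begin
  eval (map (λ (c , a) → (- c , a)) r) φ  ≡⟨ ∑ᶻ-map _ r ⟩
  ∑[ (c , a) ← r ] (- c * φ a)            ≡⟨ ∑ᶻ-cong r (λ (c , a) → ℤ.neg-distribˡ-* c (φ a)) ⟨
  ∑[ (c , a) ← r ] (- (c * φ a))          ≡⟨ ∑ᶻ-neg r ⟩
  - eval r φ                              ∎))
  where open ≡-Reasoning

-- The converse of `eval⇒≈ᴾ`, reduced to `eval-≈0` for the difference. It allows any functional to
-- be applied to the equation defining ℳ.
eval-resp-≈ᴾ : ∀ {p r : Poly n} φ → p ≈ᴾ r → eval p φ ≡ eval r φ
eval-resp-≈ᴾ {p = p} {r} φ p≈r = ℤ.i-j≡0⇒i≡j _ _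
  (trans (sym (eval-- p)) (eval-≈0 (p -ᴾ r) φ difference≈0))
  where
  difference≈0 : p -ᴾ r ≈ᴾ []
  difference≈0 a = begin
    coeff (p -ᴾ r) a             ≡⟨ coeff≡eval (p -ᴾ r) a ⟩
    eval (p -ᴾ r) (δ a)          ≡⟨ eval-- p ⟩
    eval p (δ a) - eval r (δ a)  ≡⟨ cong₂ _-_ (coeff≡eval p a) (coeff≡eval r a) ⟨
    coeff p a - coeff r a        ≡⟨ ℤ.i≡j⇒i-j≡0 (p≈r a) ⟩
    0ℤ                           ∎
    where open ≡-Reasoning

eval-mono : ∀ (a : Mon n) φ → eval (mono a) φ ≡ φ a
eval-mono a φ = trans (ℤ.+-identityʳ _) (ℤ.*-identityˡ (φ a))

eval-∑ : ∀ (xs : List A) (p : A → Poly n) φ → eval (∑ xs p) φ ≡ ∑[ x ← xs ] eval (p x) φ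
eval-∑ xs p φ = ∑ᶻ-concatMap p xs

eval-* : ∀ (p r : Poly n) φ → eval (p *ᴾ r) φ ≡ eval p (λ a → eval r (λ b → φ (a *ᴹ b)))
eval-* p r φ = trans (∑ᶻ-concatMap (λ (c , a) → map (λ (d , b) → (c * d , a *ᴹ b)) r) p)
  (∑ᶻ-cong p λ (c , a) → begin
    eval (map (λ (d , b) → (c * d , a *ᴹ b)) r) φ  ≡⟨ ∑ᶻ-map _ r ⟩
    ∑[ (d , b) ← r ] (c * d * φ (a *ᴹ b))          ≡⟨ ∑ᶻ-cong r (λ (d , b) → ℤ.*-assoc c d _) ⟩
    ∑[ (d , b) ← r ] (c * (d * φ (a *ᴹ b)))        ≡⟨ ∑ᶻ-*ˡ r c ⟩
    c * eval r (λ b → φ (a *ᴹ b))                  ∎)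
  where open ≡-Reasoning

eval-at-q=1 : ∀ {m} (p : Poly (suc m)) φ → eval (at-q=1 p) φ ≡ eval p (φ ∘ Vec.tail)
eval-at-q=1 p φ = ∑ᶻ-map _ p

private variable
  m : ℕ

-- Monomials and subsets

*ᴹ-comm : ∀ (a b : Mon n) → a *ᴹ b ≡ b *ᴹ a
*ᴹ-comm = zipWith-comm ℕ.+-comm

*ᴹ-assoc : ∀ (a b c : Mon n) → (a *ᴹ b) *ᴹ c ≡ a *ᴹ (b *ᴹ c)
*ᴹ-assoc = zipWith-assoc ℕ.+-assoc

*ᴹ-identityˡ : ∀ (a : Mon n) → Vec.replicate _ 0 *ᴹ a ≡ a
*ᴹ-identityˡ = zipWith-identityˡ ℕ.+-identityˡ

*ᴹ-identityʳ : ∀ (a : Mon n) → a *ᴹ Vec.replicate _ 0 ≡ a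
*ᴹ-identityʳ a = trans (*ᴹ-comm a _) (*ᴹ-identityˡ a)

*ᴹ-interchange : ∀ (a b c d : Mon n) → (a *ᴹ b) *ᴹ (c *ᴹ d) ≡ (a *ᴹ c) *ᴹ (b *ᴹ d)
*ᴹ-interchange a b c d = begin
  (a *ᴹ b) *ᴹ (c *ᴹ d)  ≡⟨ *ᴹ-assoc a b _ ⟩
  a *ᴹ (b *ᴹ (c *ᴹ d))  ≡⟨ cong (a *ᴹ_) (*ᴹ-assoc b c d) ⟨
  a *ᴹ ((b *ᴹ c) *ᴹ d)  ≡⟨ cong (λ z → a *ᴹ (z *ᴹ d)) (*ᴹ-comm b c) ⟩
  a *ᴹ ((c *ᴹ b) *ᴹ d)  ≡⟨ cong (a *ᴹ_) (*ᴹ-assoc c b d) ⟩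
  a *ᴹ (c *ᴹ (b *ᴹ d))  ≡⟨ *ᴹ-assoc a c _ ⟨
  (a *ᴹ c) *ᴹ (b *ᴹ d)  ∎
  where open ≡-Reasoning

-- Exponents are truncated at 0: a genuine quotient only when b divides a.
_/ᴹ_ : Mon n → Mon n → Mon n
_/ᴹ_ = Vec.zipWith _∸_

*ᴹ-/ᴹ-cancelˡ : ∀ (a b : Mon n) → (a *ᴹ b) /ᴹ a ≡ b
*ᴹ-/ᴹ-cancelˡ []      []      = refl
*ᴹ-/ᴹ-cancelˡ (x ∷ a) (y ∷ b) = cong₂ _∷_ (ℕ.m+n∸m≡n x y) (*ᴹ-/ᴹ-cancelˡ a b)

support≥ : ℕ → Mon n → Subset n
support≥ i = Vec.map (i ≤ᵇ_)

-- Exponents of the product are 2 on `p ∩ q`, 1 on the symmetric difference and 0 elsewhere. The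
-- monomial thus remembers the intersection and the union, but not how the symmetric difference is
-- shared out.
support≥2-𝐱𝐱 : ∀ (p q : Subset n) → support≥ 2 ((𝐱^ p) *ᴹ (𝐱^ q)) ≡ p ∩ q
support≥2-𝐱𝐱 []          []          = refl
support≥2-𝐱𝐱 (true  ∷ p) (true  ∷ q) = cong (_ ∷_) (support≥2-𝐱𝐱 p q)
support≥2-𝐱𝐱 (true  ∷ p) (false ∷ q) = cong (_ ∷_) (support≥2-𝐱𝐱 p q)
support≥2-𝐱𝐱 (false ∷ p) (true  ∷ q) = cong (_ ∷_) (support≥2-𝐱𝐱 p q)
support≥2-𝐱𝐱 (false ∷ p) (false ∷ q) = cong (_ ∷_) (support≥2-𝐱𝐱 p q)

support≥1-𝐱𝐱 : ∀ (p q : Subset n) → support≥ 1 ((𝐱^ p) *ᴹ (𝐱^ q)) ≡ p ∪ q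
support≥1-𝐱𝐱 []          []          = refl
support≥1-𝐱𝐱 (true  ∷ p) (true  ∷ q) = cong (_ ∷_) (support≥1-𝐱𝐱 p q)
support≥1-𝐱𝐱 (true  ∷ p) (false ∷ q) = cong (_ ∷_) (support≥1-𝐱𝐱 p q)
support≥1-𝐱𝐱 (false ∷ p) (true  ∷ q) = cong (_ ∷_) (support≥1-𝐱𝐱 p q)
support≥1-𝐱𝐱 (false ∷ p) (false ∷ q) = cong (_ ∷_) (support≥1-𝐱𝐱 p q)

𝐱^-∩-∪ : ∀ (p q : Subset n) → (𝐱^ p) *ᴹ (𝐱^ q) ≡ (𝐱^ (p ∩ q)) *ᴹ (𝐱^ (p ∪ q))
𝐱^-∩-∪ []          []          = refl
𝐱^-∩-∪ (true  ∷ p) (true  ∷ q) = cong (_ ∷_) (𝐱^-∩-∪ p q)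
𝐱^-∩-∪ (true  ∷ p) (false ∷ q) = cong (_ ∷_) (𝐱^-∩-∪ p q)
𝐱^-∩-∪ (false ∷ p) (true  ∷ q) = cong (_ ∷_) (𝐱^-∩-∪ p q)
𝐱^-∩-∪ (false ∷ p) (false ∷ q) = cong (_ ∷_) (𝐱^-∩-∪ p q)

𝐱^⊥ : 𝐱^ (⊥ {n}) ≡ Vec.replicate n 0
𝐱^⊥ {zero}  = refl
𝐱^⊥ {suc n} = cong (0 ∷_) 𝐱^⊥

𝐱^-∪ : ∀ (p q : Subset n) → Empty (p ∩ q) → 𝐱^ (p ∪ q) ≡ (𝐱^ p) *ᴹ (𝐱^ q)
𝐱^-∪ p q disjoint = sym (begin
  (𝐱^ p) *ᴹ (𝐱^ q)              ≡⟨ 𝐱^-∩-∪ p q ⟩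
  (𝐱^ (p ∩ q)) *ᴹ (𝐱^ (p ∪ q))  ≡⟨ cong (λ s → (𝐱^ s) *ᴹ (𝐱^ (p ∪ q))) (Empty-unique disjoint) ⟩
  (𝐱^ ⊥) *ᴹ (𝐱^ (p ∪ q))        ≡⟨ cong (_*ᴹ (𝐱^ (p ∪ q))) 𝐱^⊥ ⟩
  Vec.replicate _ 0 *ᴹ (𝐱^ (p ∪ q)) ≡⟨ *ᴹ-identityˡ _ ⟩
  𝐱^ (p ∪ q)                    ∎)
  where open ≡-Reasoning

select : ∀ {P : Fin n → Set} → Decidable P → Subset n
select P? = Vec.tabulate (does ∘ P?)

module _ {P : Fin n → Set} (P? : Decidable P) where

  ∈-select⁺ : ∀ {g} → P g → g Subset.∈ select P?
  ∈-select⁺ {g} Pg =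
    lookup⇒[]= g _ (trans (lookup∘tabulate (does ∘ P?) g) (dec-true (P? g) Pg))

  ∈-select⁻ : ∀ {g} → g Subset.∈ select P? → P g
  ∈-select⁻ {g} g∈ with P? g | trans (sym (lookup∘tabulate (does ∘ P?) g)) ([]=⇒lookup g∈)
  ... | yes Pg | _ = Pg

∈-∪⁻ : ∀ {p q : Subset n} {g} → g Subset.∈ p ∪ q → g Subset.∈ p ⊎ g Subset.∈ q
∈-∪⁻ = x∈p∪q⁻ _ _

∈-∩⁻ : ∀ {p q : Subset n} {g} → g Subset.∈ p ∩ q → g Subset.∈ p × g Subset.∈ q
∈-∩⁻ = x∈p∩q⁻ _ _

p∩∁q∪p∩q≡p : ∀ (p q : Subset n) → (p ∩ ∁ q) ∪ (p ∩ q) ≡ p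
p∩∁q∪p∩q≡p p q = ⊆-antisym
  (λ g∈ → [ p∩q⊆p p (∁ q) , p∩q⊆p p q ]′ (∈-∪⁻ g∈))
  λ {g} g∈p → x∈p∪q⁺ (split g∈p (g ∈? q))
  where
  split : ∀ {g} → g Subset.∈ p → _ → g Subset.∈ p ∩ ∁ q ⊎ g Subset.∈ p ∩ q
  split g∈p (yes g∈q) = inj₂ (x∈p∩q⁺ (g∈p , g∈q))
  split g∈p (no  g∉q) = inj₁ (x∈p∩q⁺ (g∈p , x∉p⇒x∈∁p g∉q))

q⊆p⇒q∪p∩∁q≡p : ∀ (p q : Subset n) → q ⊆ p → q ∪ (p ∩ ∁ q) ≡ p
q⊆p⇒q∪p∩∁q≡p p q q⊆p = ⊆-antisym
  (λ g∈ → [ q⊆p , p∩q⊆p p (∁ q) ]′ (∈-∪⁻ g∈))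
  λ {g} g∈p → x∈p∪q⁺ (split g∈p (g ∈? q))
  where
  split : ∀ {g} → g Subset.∈ p → _ → g Subset.∈ q ⊎ g Subset.∈ p ∩ ∁ q
  split g∈p (yes g∈q) = inj₁ g∈q
  split g∈p (no  g∉q) = inj₂ (x∈p∩q⁺ (g∈p , x∉p⇒x∈∁p g∉q))

∈-subsets : ∀ (p : Subset n) → p ∈ subsets n
∈-subsets []            = here refl
∈-subsets (outside ∷ p) = ∈-++⁺ˡ (∈-map⁺ (outside ∷_) (∈-subsets p))
∈-subsets (inside  ∷ p) = ∈-++⁺ʳ _ (∈-map⁺ (inside ∷_) (∈-subsets p))

subsets-! : ∀ n → Unique (subsets n)
subsets-! zero    = All.[] ∷ []
subsets-! (suc n) = Unique.++⁺
  (Unique.map⁺ (cong Vec.tail) (subsets-! n)) (Unique.map⁺ (cong Vec.tail) (subsets-! n)) disjoint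
  where
  disjoint : ∀ {p} → ¬ (p ∈ map (outside ∷_) (subsets n) × p ∈ map (inside ∷_) (subsets n))
  disjoint (p∈ˡ , p∈ʳ) with ∈-map⁻ (outside ∷_) p∈ˡ | ∈-map⁻ (inside ∷_) p∈ʳ
  ... | _ , _ , refl | _ , _ , ()

subsetsOf : Subset m → List (Subset m)
subsetsOf C = filter (_⊆? C) (subsets _)

-- Such a set is `A` together with a free choice of edges outside `A ∪ B`. This gives all four sums
-- `𝒯` in ℳ the same index list, the subsets of `Eᵉᶠ`.
∑ᶻ-between : ∀ (A B : Subset m) {h : Subset m → ℤ} → Empty (A ∩ B) →
  ∑ᶻ (filter (λ F → (A ⊆? F) ×-dec ¬? (nonempty? (F ∩ B))) (subsets m)) h
    ≡ ∑[ F ← subsetsOf (∁ (A ∪ B)) ] h (F ∪ A)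
∑ᶻ-between {m} A B {h} disjoint = ∑ᶻ-reindex (_∩ ∁ A) (_∪ A)
  (Unique.filter⁺ between? (subsets-! m)) (Unique.filter⁺ (_⊆? ∁ (A ∪ B)) (subsets-! m))
  to from (λ F∈ → cong h (sym (proj₂ (to F∈))))
  where
  between? : Decidable (λ F → A ⊆ F × Empty (F ∩ B))
  between? F = (A ⊆? F) ×-dec ¬? (nonempty? (F ∩ B))

  to : ∀ {F} → F ∈ filter between? (subsets m) →
       F ∩ ∁ A ∈ subsetsOf (∁ (A ∪ B)) × (F ∩ ∁ A) ∪ A ≡ F
  to {F} F∈ with _ , A⊆F , F∩B≡∅ ← ∈-filter⁻ between? {xs = subsets m} F∈ =
    ∈-filter⁺ (_⊆? ∁ (A ∪ B)) (∈-subsets _) avoids ,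
    trans (∪-comm _ A) (q⊆p⇒q∪p∩∁q≡p F A A⊆F)
    where
    avoids : F ∩ ∁ A ⊆ ∁ (A ∪ B)
    avoids g∈ = x∉p⇒x∈∁p λ g∈A∪B → let g∈F , g∈∁A = ∈-∩⁻ g∈ in
      [ x∈∁p⇒x∉p g∈∁A , (λ g∈B → F∩B≡∅ (_ , x∈p∩q⁺ (g∈F , g∈B))) ]′ (∈-∪⁻ g∈A∪B)

  from : ∀ {F} → F ∈ subsetsOf (∁ (A ∪ B)) →
         F ∪ A ∈ filter between? (subsets m) × (F ∪ A) ∩ ∁ A ≡ F
  from {F} F∈ with _ , F⊆ ← ∈-filter⁻ (_⊆? ∁ (A ∪ B)) {xs = subsets m} F∈ =
    ∈-filter⁺ between? (∈-subsets _) (q⊆p∪q F A , avoids) , ⊆-antisym removed kept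
    where
    avoids : Empty ((F ∪ A) ∩ B)
    avoids (g , g∈) with ∈-∩⁻ g∈
    ... | g∈F∪A , g∈B = [ (λ g∈F → x∈∁p⇒x∉p (F⊆ g∈F) (q⊆p∪q A B g∈B))
                        , (λ g∈A → disjoint (g , x∈p∩q⁺ (g∈A , g∈B))) ]′ (∈-∪⁻ g∈F∪A)
    removed : (F ∪ A) ∩ ∁ A ⊆ F
    removed g∈ with ∈-∩⁻ g∈
    ... | g∈F∪A , g∈∁A = [ (λ g∈F → g∈F) , (λ g∈A → contradiction g∈A (x∈∁p⇒x∉p g∈∁A)) ]′ (∈-∪⁻ g∈F∪A)
    kept : F ⊆ (F ∪ A) ∩ ∁ A
    kept g∈F = x∈p∩q⁺ (p⊆p∪q A g∈F , x∉p⇒x∈∁p (x∈∁p⇒x∉p (F⊆ g∈F) ∘ p⊆p∪q B))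

-- Components

module _ {A : Set} {_~_ : A → A → Set} (~-equiv : IsEquivalence _~_) where

  private module ~ = IsEquivalence ~-equiv

  AllPairs-lookup-injective : ∀ {xs} → AllPairs (λ x y → ¬ x ~ y) xs →
    ∀ i j → lookup xs i ~ lookup xs j → i ≡ j
  AllPairs-lookup-injective (_  ∷ _)  zero    zero    _   = refl
  AllPairs-lookup-injective (x≁ ∷ _)  zero    (suc j) x~y =
    contradiction x~y (All.lookup x≁ (∈-lookup j))
  AllPairs-lookup-injective (x≁ ∷ _)  (suc i) zero    x~y =
    contradiction (~.sym x~y) (All.lookup x≁ (∈-lookup i))
  AllPairs-lookup-injective (_  ∷ ≁s) (suc i) (suc j) x~y =
    cong suc (AllPairs-lookup-injective ≁s i j x~y)

  AllPairs-∈-injective : ∀ {xs x y} → AllPairs (λ x y → ¬ x ~ y) xs →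
    x ∈ xs → y ∈ xs → x ~ y → x ≡ y
  AllPairs-∈-injective (_  ∷ _)  (here refl) (here refl) _   = refl
  AllPairs-∈-injective (x≁ ∷ _)  (here refl) (there y∈)  x~y = contradiction x~y (All.lookup x≁ y∈)
  AllPairs-∈-injective (y≁ ∷ _)  (there x∈)  (here refl) x~y =
    contradiction (~.sym x~y) (All.lookup y≁ x∈)
  AllPairs-∈-injective (_  ∷ ≁s) (there x∈)  (there y∈)  x~y = AllPairs-∈-injective ≁s x∈ y∈ x~y

  Transversal : List A → Set
  Transversal xs = AllPairs (λ x y → ¬ x ~ y) xs × (∀ x → Any (x ~_) xs)

  -- Pigeonhole: each member of `xs` is sent to the position of a related member of `ys`, and two
  -- members sent to the same position would be related to each other.
  separated-length≤ : ∀ {xs ys} → AllPairs (λ x y → ¬ x ~ y) xs → (∀ x → Any (x ~_) ys) →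
                      length xs ≤ length ys
  separated-length≤ {xs} {ys} separated covered = Fin.injective⇒≤ {f = f} λ {i} {j} fi≡fj →
    AllPairs-lookup-injective separated i j
      (~.trans (related i) (~.sym (subst (λ t → lookup xs j ~ lookup ys t) (sym fi≡fj) (related j))))
    where
    f : Fin (length xs) → Fin (length ys)
    f i = Any.index (covered (lookup xs i))
    related : ∀ i → lookup xs i ~ lookup ys (f i)
    related i = lookup-index (covered (lookup xs i))

  -- Hence `k` may be computed from any transversal, not only from the one that `deduplicate`
  -- produces.
  transversal-length : ∀ {xs ys} → Transversal xs → Transversal ys → length xs ≡ length ys
  transversal-length (separated , covered) (separated′ , covered′) =
    ℕ.≤-antisym (separated-length≤ separated covered′) (separated-length≤ separated′ covered)

module _ {n m : ℕ} (G : Graph n m) where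

  open Graph G

  private variable
    F H : Subset m
    g h : Fin m
    u v w : Fin n

  end₁ end₂ : Fin m → Fin n
  end₁ g = proj₁ (ends g)
  end₂ g = proj₂ (ends g)

  conn-sym : Conn ends F u v → Conn ends F v u
  conn-sym = symmetric _

  conn-mono : F ⊆ H → Conn ends F u v → Conn ends H u v
  conn-mono F⊆H = EqClosure.map λ (g , g∈F , eq) → g , F⊆H g∈F , eq

  conn-edge : g Subset.∈ F → Conn ends F (end₁ g) (end₂ g)
  conn-edge g∈F = fwd (_ , g∈F , refl) ◅ ε

  -- Used to separate vertices: a property closed along every edge in both directions cannot hold at
  -- only one of two connected vertices.
  conn-invariant : ∀ {P : Fin n → Set} →
    (∀ {g} → g Subset.∈ F → (P (end₁ g) → P (end₂ g)) × (P (end₂ g) → P (end₁ g))) →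
    Conn ends F u v → P u → P v
  conn-invariant inv ε                           Pu = Pu
  conn-invariant inv (fwd (_ , g∈F , refl) ◅ p) Pu = conn-invariant inv p (proj₁ (inv g∈F) Pu)
  conn-invariant inv (bwd (_ , g∈F , refl) ◅ p) Pu = conn-invariant inv p (proj₂ (inv g∈F) Pu)

  -- A walk needs `g` at most once. The disjunction is an invariant of the far end of the walk: an
  -- edge of `F` extends it by `move`, and crossing `g` a second time, in `forth` or `back`, leaves
  -- a connection within `F`.
  conn-∪⁅⁆⁻ : Conn ends (F ∪ ⁅ g ⁆) u v → Conn ends F u v ⊎ Joins G F u v g
  conn-∪⁅⁆⁻ {F} {g} {u} p = conn-invariant {P = λ w → Conn ends F u w ⊎ Joins G F u w g} inv p (inj₁ ε)
    where
    move : Conn ends F v w → Conn ends F u v ⊎ Joins G F u v g → Conn ends F u w ⊎ Joins G F u w g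
    move r (inj₁ p)              = inj₁ (p ◅◅ r)
    move r (inj₂ (inj₁ (p , q))) = inj₂ (inj₁ (p , q ◅◅ r))
    move r (inj₂ (inj₂ (p , q))) = inj₂ (inj₂ (p ◅◅ r , q))
    forth : Conn ends F u (end₁ g) ⊎ Joins G F u (end₁ g) g →
            Conn ends F u (end₂ g) ⊎ Joins G F u (end₂ g) g
    forth (inj₁ p)              = inj₂ (inj₁ (conn-sym p , ε))
    forth (inj₂ (inj₁ (p , q))) = inj₁ (conn-sym p ◅◅ conn-sym q)
    forth (inj₂ (inj₂ (p , q))) = inj₁ (conn-sym q)
    back : Conn ends F u (end₂ g) ⊎ Joins G F u (end₂ g) g →
           Conn ends F u (end₁ g) ⊎ Joins G F u (end₁ g) g
    back (inj₁ p)              = inj₂ (inj₂ (ε , conn-sym p))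
    back (inj₂ (inj₁ (p , q))) = inj₁ (conn-sym p)
    back (inj₂ (inj₂ (p , q))) = inj₁ (conn-sym q ◅◅ conn-sym p)
    inv : ∀ {h} → h Subset.∈ F ∪ ⁅ g ⁆ → _
    inv h∈ with ∈-∪⁻ h∈
    ... | inj₁ h∈F = move (conn-edge h∈F) , move (conn-sym (conn-edge h∈F))
    ... | inj₂ h∈g with refl ← x∈⁅y⁆⇒x≡y g h∈g = forth , back

  joins-mono : F ⊆ H → Joins G F u v g → Joins G H u v g
  joins-mono F⊆H = Sum.map both both
    where
    both : ∀ {u v u′ v′} → Conn ends _ u v × Conn ends _ u′ v′ → Conn ends _ u v × Conn ends _ u′ v′
    both (p , q) = conn-mono F⊆H p , conn-mono F⊆H q

  joins⇒conn : g Subset.∈ F → Joins G F u v g → Conn ends F u v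
  joins⇒conn g∈F (inj₁ (p , q)) = conn-sym p ◅◅ conn-edge g∈F ◅◅ q
  joins⇒conn g∈F (inj₂ (p , q)) = conn-sym q ◅◅ conn-sym (conn-edge g∈F) ◅◅ p

  -- Replaces the vertices witnessed in `Paracel` and `Smoot` by the ends of `e`, so that later
  -- arguments can work with one fixed pair of vertices.
  joins-ends : Joins G F u v g → Joins G F u v h → Joins G F (end₁ g) (end₂ g) h
  joins-ends (inj₁ (p , q)) (inj₁ (r , s)) = inj₁ (r ◅◅ conn-sym p , s ◅◅ conn-sym q)
  joins-ends (inj₁ (p , q)) (inj₂ (r , s)) = inj₂ (r ◅◅ conn-sym q , s ◅◅ conn-sym p)
  joins-ends (inj₂ (p , q)) (inj₁ (r , s)) = inj₂ (r ◅◅ conn-sym q , s ◅◅ conn-sym p)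
  joins-ends (inj₂ (p , q)) (inj₂ (r , s)) = inj₁ (r ◅◅ conn-sym p , s ◅◅ conn-sym q)

  joins-¬conn-ends : ¬ Conn ends F u v → Joins G F u v g → ¬ Conn ends F (end₁ g) (end₂ g)
  joins-¬conn-ends ¬uv (inj₁ (p , q)) r = ¬uv (conn-sym p ◅◅ r ◅◅ q)
  joins-¬conn-ends ¬uv (inj₂ (p , q)) r = ¬uv (conn-sym q ◅◅ conn-sym r ◅◅ p)

  joins-self : Joins G F (end₁ g) (end₂ g) g
  joins-self = inj₁ (ε , ε)

  representatives : Subset m → List (Fin n)
  representatives F = deduplicate (conn? ends F) (allFin n)

  conn-equiv : ∀ F → IsEquivalence (Conn ends F)
  conn-equiv F = isEquivalence (Link ends F)

  representatives-transversal : ∀ F → Transversal (conn-equiv F) (representatives F)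
  representatives-transversal F =
    DecSetoid.deduplicate-! connDecSetoid (allFin n) ,
    λ x → deduplicate⁺ (conn? ends F) (λ y~z x~y → x~y ◅◅ conn-sym y~z)
      (Any.map (λ { refl → ε }) (∈-allFin x))
    where
    connDecSetoid : DecSetoid _ _
    connDecSetoid = record
      { isDecEquivalence = record { isEquivalence = conn-equiv F ; _≟_ = conn? ends F } }

  -- An edge inside a component creates no new connection, so representatives for `F` also serve for
  -- `F ∪ ⁅ g ⁆`.
  k-∪⁅⁆-conn : ∀ F g → Conn ends F (end₁ g) (end₂ g) → k G (F ∪ ⁅ g ⁆) ≡ k G F
  k-∪⁅⁆-conn F g a~b with representatives-transversal F
  ... | separated , covered = transversal-length (conn-equiv (F ∪ ⁅ g ⁆))
    (representatives-transversal (F ∪ ⁅ g ⁆))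
    (AllPairs.map (_∘ unmerged) separated , Any.map (conn-mono (p⊆p∪q ⁅ g ⁆)) ∘ covered)
    where
    unmerged : Conn ends (F ∪ ⁅ g ⁆) u v → Conn ends F u v
    unmerged p with conn-∪⁅⁆⁻ p
    ... | inj₁ q              = q
    ... | inj₂ (inj₁ (q , r)) = conn-sym q ◅◅ a~b ◅◅ r
    ... | inj₂ (inj₂ (q , r)) = conn-sym r ◅◅ conn-sym a~b ◅◅ q

  -- A transversal of the coarser partition misses exactly one of the two merged classes.
  split-transversal : ∀ {F H c d zs} → F ⊆ H → Conn ends H c d → ¬ Conn ends F c d →
    (∀ {u v} → Conn ends H u v →
      Conn ends F u v ⊎ (Conn ends F u c × Conn ends F d v) ⊎ (Conn ends F u d × Conn ends F c v)) →
    Transversal (conn-equiv H) zs → Any (Conn ends F c) zs → Transversal (conn-equiv F) (d ∷ zs)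
  split-transversal {F} {H} {c} {d} {zs} F⊆H c~d c≁d split (separated , covered) c∈ =
    (All.tabulate d≁ ∷ AllPairs.map (_∘ conn-mono F⊆H) separated) , λ x → cover (covered x)
    where
    d≁ : ∀ {z} → z ∈ zs → ¬ Conn ends F d z
    -- The representative `z′` that is `F`-connected to `c` and the vertex `z` are `H`-connected
    -- through `c` and `d`. Separation makes them equal, which would connect `c` to `d` in `F`.
    d≁ {z} z∈ d~z = c≁d (c~z′ ◅◅ subst (λ y → Conn ends F y d) (sym z′≡z) (conn-sym d~z))
      where
      z′∈,c~z′ = find c∈
      c~z′ = proj₂ (proj₂ z′∈,c~z′)
      z′≡z = AllPairs-∈-injective (conn-equiv H) separated (proj₁ (proj₂ z′∈,c~z′)) z∈
        (conn-mono F⊆H (conn-sym c~z′) ◅◅ c~d ◅◅ conn-mono F⊆H d~z)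

    cover : ∀ {x} → Any (Conn ends H x) zs → Any (Conn ends F x) (d ∷ zs)
    cover x∈ with find x∈
    ... | z , z∈ , x~z with split x~z
    ...   | inj₁ p              = there (lose z∈ p)
    ...   | inj₂ (inj₁ (p , _)) = there (Any.map (p ◅◅_) c∈)
    ...   | inj₂ (inj₂ (p , _)) = here p

  -- The representative `z` of the merged component is `F`-connected to exactly one end of `g`;
  -- adding the other end to the list gives a transversal for `F`.
  k-∪⁅⁆-¬conn : ∀ F g → ¬ Conn ends F (end₁ g) (end₂ g) → k G F ≡ suc (k G (F ∪ ⁅ g ⁆))
  k-∪⁅⁆-¬conn F g a≁b = conclude (find (proj₂ transversal (end₁ g)))
    where
    F+g = F ∪ ⁅ g ⁆
    F⊆F+g : F ⊆ F+g
    F⊆F+g = p⊆p∪q ⁅ g ⁆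
    a~b : Conn ends F+g (end₁ g) (end₂ g)
    a~b = conn-edge (q⊆p∪q F ⁅ g ⁆ (x∈⁅x⁆ g))
    transversal = representatives-transversal F+g

    split : ∀ {u v} → Conn ends F+g u v → Conn ends F u v
          ⊎ (Conn ends F u (end₁ g) × Conn ends F (end₂ g) v)
          ⊎ (Conn ends F u (end₂ g) × Conn ends F (end₁ g) v)
    split = Sum.map₂ (Sum.map (λ (p , q) → conn-sym p , q) (λ (p , q) → conn-sym q , p)) ∘ conn-∪⁅⁆⁻

    conclude : ∃[ z ] z ∈ representatives F+g × Conn ends F+g (end₁ g) z → k G F ≡ suc (k G F+g)
    conclude (z , z∈ , a~z) with split a~z
    ... | inj₁ p = transversal-length (conn-equiv F) (representatives-transversal F)
      (split-transversal F⊆F+g a~b a≁b split transversal (lose z∈ p))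
    -- Here `z` lies in the `F`-component of `end₂ g`, so the two ends exchange roles and `end₁ g`
    -- is the representative to be added.
    ... | inj₂ (inj₁ (_ , q)) = transversal-length (conn-equiv F) (representatives-transversal F)
      (split-transversal F⊆F+g (conn-sym a~b) (a≁b ∘ conn-sym)
        (Sum.map₂ Sum.swap ∘ split) transversal (lose z∈ q))
    ... | inj₂ (inj₂ (p , _)) = contradiction p a≁b

  -- Component counts of paracels

  module _ (e f : Fin m) where

    paracel-ends : Paracel G e f F → ¬ Conn ends F (end₁ e) (end₂ e) × Joins G F (end₁ e) (end₂ e) f
    paracel-ends (_ , u , v , u≁v , je , jf) = joins-¬conn-ends u≁v je , joins-ends je jf

    -- The left side is the fall in `k` when `e` is added to `F`, minus the fall when `e` is added
    -- to `F ∪ ⁅ f ⁆`. The two differ exactly when the ends of `e` are separated in `F` but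
    -- connected once `f` is added, that is, when `F` is a paracel.
    paracel-nullity : ∀ {F} → F ⊆ Eᵉᶠ G e f →
      (ℤ.+ (k G (F ∪ (⁅ e ⁆ ∪ ⁅ f ⁆))) + ℤ.+ (k G F)) - (ℤ.+ (k G (F ∪ ⁅ e ⁆)) + ℤ.+ (k G (F ∪ ⁅ f ⁆)))
        ≡ (if does (paracel? G e f F) then 1ℤ else 0ℤ)
    paracel-nullity {F} F⊆E
      -- Adding both edges is rewritten as adding `f` and then `e`, so that the one-edge lemmas
      -- apply.
      rewrite trans (cong (F ∪_) (∪-comm ⁅ e ⁆ ⁅ f ⁆)) (sym (∪-assoc F ⁅ f ⁆ ⁅ e ⁆))
      with conn? ends F (end₁ e) (end₂ e) | conn? ends (F ∪ ⁅ f ⁆) (end₁ e) (end₂ e)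
    ... | yes a~b | _
      rewrite dec-false (paracel? G e f F) (λ p → proj₁ (paracel-ends p) a~b)
            | k-∪⁅⁆-conn F e a~b
            | k-∪⁅⁆-conn (F ∪ ⁅ f ⁆) e (conn-mono (p⊆p∪q ⁅ f ⁆) a~b) =
      solve-zero (ℤ.+ k G F) (ℤ.+ k G (F ∪ ⁅ f ⁆))
      where
      solve-zero : ∀ x y → (y + x) - (x + y) ≡ 0ℤ
      solve-zero = solve-∀
    ... | no a≁b | yes a~b
      rewrite dec-true (paracel? G e f F)
                (F⊆E , _ , _ , a≁b , joins-self ,
                  [ (λ p → contradiction p a≁b) , (λ j → j) ]′ (conn-∪⁅⁆⁻ a~b))
            | k-∪⁅⁆-¬conn F e a≁b
            | k-∪⁅⁆-conn (F ∪ ⁅ f ⁆) e a~b = solve-one (ℤ.+ k G (F ∪ ⁅ e ⁆)) (ℤ.+ k G (F ∪ ⁅ f ⁆))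
      where
      solve-one : ∀ x y → (y + (1ℤ + x)) - (x + y) ≡ 1ℤ
      solve-one = solve-∀
    ... | no a≁b | no a≁b′
      rewrite dec-false (paracel? G e f F)
                (λ p → a≁b′ (joins⇒conn (q⊆p∪q F ⁅ f ⁆ (x∈⁅x⁆ f))
                  (joins-mono (p⊆p∪q ⁅ f ⁆) (proj₂ (paracel-ends p)))))
            | k-∪⁅⁆-¬conn F e a≁b
            | k-∪⁅⁆-¬conn (F ∪ ⁅ f ⁆) e a≁b′ =
      solve-zero (ℤ.+ k G (F ∪ ⁅ e ⁆)) (ℤ.+ k G ((F ∪ ⁅ f ⁆) ∪ ⁅ e ⁆))
      where
      solve-zero : ∀ x y → (y + (1ℤ + x)) - (x + (1ℤ + y)) ≡ 0ℤ
      solve-zero = solve-∀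

-- Pairs of edge sets and twin monomials

module _ {n m : ℕ} (G : Graph n m) (e f : Fin m) where

  open Graph G

  private
    E : Subset m
    E = Eᵉᶠ G e f
    a b : Fin n
    a = end₁ G e
    b = end₂ G e

  smoot-joins : ∀ {F g} → Smoot G e f F g → Joins G F a b g
  smoot-joins (_ , _ , _ , _ , _ , je , _ , jg) = joins-ends G je jg

  smootIn? : ∀ F F′ → Decidable (λ g → g Subset.∈ F′ × Smoot G e f F g)
  smootIn? F F′ g = (g ∈? F′) ×-dec smoot? G e f F g

  smootsIn : (F F′ : Subset m) → Subset m
  smootsIn F F′ = select (smootIn? F F′)

  splitPair : Subset m × Subset m → (Subset m × Subset m) × Mon m
  splitPair (F , F′) = (β , F ∩ ∁ F′) , (𝐱^ (F ∩ F′)) *ᴹ (𝐱^ (F′ ∩ ∁ β))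
    where β = smootsIn F F′

  mergePair : (Subset m × Subset m) × Mon m → Subset m × Subset m
  mergePair ((β , γ) , μ) = γ ∪ support≥ 2 μ , β ∪ support≥ 1 μ

  paracelPairs : List (Subset m × Subset m)
  paracelPairs = cartesianProduct (filter (paracel? G e f) (subsetsOf E)) (subsetsOf E)

  twinTriples : List ((Subset m × Subset m) × Mon m)
  twinTriples = dependentPairs (disjointPairs G e f) (λ (β , γ) → twinMonomials G e f β γ)

  ∈-paracelPairs⁺ : ∀ {F F′} → Paracel G e f F → F′ ⊆ E → (F , F′) ∈ paracelPairs
  ∈-paracelPairs⁺ par@(F⊆E , _) F′⊆E = ∈-cartesianProduct⁺
    (∈-filter⁺ (paracel? G e f) (∈-filter⁺ (_⊆? E) (∈-subsets _) F⊆E) par)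
    (∈-filter⁺ (_⊆? E) (∈-subsets _) F′⊆E)

  ∈-paracelPairs⁻ : ∀ {F F′} → (F , F′) ∈ paracelPairs → Paracel G e f F × F′ ⊆ E
  ∈-paracelPairs⁻ FF′∈
    with ∈-cartesianProduct⁻ (filter (paracel? G e f) (subsetsOf E)) (subsetsOf E) FF′∈
  ... | F∈ , F′∈ = proj₂ (∈-filter⁻ (paracel? G e f) {xs = subsetsOf E} F∈) ,
                   proj₂ (∈-filter⁻ (_⊆? E) {xs = subsets m} F′∈)

  disjoint? : Decidable (λ ((β , γ) : Subset m × Subset m) → β ⊆ E × γ ⊆ E × Empty (β ∩ γ))
  disjoint? (β , γ) = (β ⊆? E) ×-dec (γ ⊆? E) ×-dec ¬? (nonempty? (β ∩ γ))

  ∈-twinTriples⁺ : ∀ {β γ α α′} → β ⊆ E → γ ⊆ E → Empty (β ∩ γ) → Twins G e f β γ α α′ →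
                   ((β , γ) , (𝐱^ α) *ᴹ (𝐱^ α′)) ∈ twinTriples
  ∈-twinTriples⁺ {β} {γ} β⊆E γ⊆E β∩γ≡∅ twins = ∈-dependentPairs⁺
    (∈-filter⁺ disjoint? (∈-cartesianProduct⁺ (∈-subsets _) (∈-subsets _)) (β⊆E , γ⊆E , β∩γ≡∅))
    (∈-deduplicate⁺ _≟ᴹ_ (∈-map⁺ (λ (α , α′) → (𝐱^ α) *ᴹ (𝐱^ α′))
      (∈-filter⁺ (twins? G e f β γ) (∈-cartesianProduct⁺ (∈-subsets _) (∈-subsets _)) twins)))

  ∈-twinTriples⁻ : ∀ {β γ μ} → ((β , γ) , μ) ∈ twinTriples →
    (β ⊆ E × γ ⊆ E × Empty (β ∩ γ)) ×
    ∃[ α ] ∃[ α′ ] μ ≡ (𝐱^ α) *ᴹ (𝐱^ α′) × Twins G e f β γ α α′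
  ∈-twinTriples⁻ {β} {γ} βγμ∈ with ∈-dependentPairs⁻ (disjointPairs G e f) βγμ∈
  ... | βγ∈ , μ∈
    with ∈-map⁻ (λ (α , α′) → (𝐱^ α) *ᴹ (𝐱^ α′)) (∈-deduplicate⁻ _≟ᴹ_ _ μ∈)
  ... | (α , α′) , αα′∈ , eq =
    proj₂ (∈-filter⁻ disjoint? {xs = cartesianProduct (subsets m) (subsets m)} βγ∈) ,
    α , α′ , eq ,
    proj₂ (∈-filter⁻ (twins? G e f β γ) {xs = cartesianProduct (subsets m) (subsets m)} αα′∈)

  -- From a paracel pair to a twin triple

  module _ {F F′ : Subset m} (paracel : Paracel G e f F) (F′⊆E : F′ ⊆ E) where

    private
      β γ D : Subset m
      β = smootsIn F F′
      γ = F ∩ ∁ F′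
      D = F′ ∩ ∁ β

      F⊆E : F ⊆ E
      F⊆E = proj₁ paracel
      a≁b : ¬ Conn ends F a b
      a≁b = proj₁ (paracel-ends G e f paracel)
      f-joins : Joins G F a b f
      f-joins = proj₂ (paracel-ends G e f paracel)

      ∈β⁻ : ∀ {g} → g Subset.∈ β → g Subset.∈ F′ × Smoot G e f F g
      ∈β⁻ = ∈-select⁻ (smootIn? F F′)

      β⊆F′ : β ⊆ F′
      β⊆F′ = proj₁ ∘ ∈β⁻

      β∩F≡∅ : ∀ {g} → g Subset.∈ β → ¬ g Subset.∈ F
      β∩F≡∅ g∈β = proj₁ (proj₂ (proj₂ (∈β⁻ g∈β)))

      F∩F′⊆D : F ∩ F′ ⊆ D
      F∩F′⊆D g∈ = let g∈F , g∈F′ = ∈-∩⁻ g∈ in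
        x∈p∩q⁺ (g∈F′ , x∉p⇒x∈∁p λ g∈β → β∩F≡∅ g∈β g∈F)

      -- Such an edge would be a smoot of `F` lying in `F′`, hence in `β`, which `D` excludes.
      D─F-¬joins : ∀ {g} → g Subset.∈ D → ¬ g Subset.∈ F → ¬ Joins G F a b g
      D─F-¬joins g∈D g∉F jg = let g∈F′ , g∈∁β = ∈-∩⁻ g∈D in
        x∈∁p⇒x∉p g∈∁β (∈-select⁺ (smootIn? F F′) 
          (g∈F′ , F′⊆E g∈F′ , g∉F , a , b , a≁b , joins-self G , f-joins , jg))

      -- Since `γ ∪ α` contains `F`, it inherits every `Joins` from the paracel `F`. Compatibility
      -- thus reduces to keeping `a` and `b` apart.
      compatible : ∀ {α} → F ∩ F′ ⊆ α → α ⊆ D → ¬ Conn ends (γ ∪ α) a b → Compatible G e f β γ α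
      compatible {α} F∩F′⊆α α⊆D separated =
        F′⊆E ∘ α⊆F′ ,
        (λ (_ , g∈) → let g∈α , g∈β = ∈-∩⁻ g∈ in α∌β g∈α g∈β) ,
        (λ (_ , g∈) → let g∈α , g∈γ = ∈-∩⁻ g∈ in x∈∁p⇒x∉p (p∩q⊆q F (∁ F′) g∈γ) (α⊆F′ g∈α)) ,
        (([ F⊆E ∘ p∩q⊆p F (∁ F′) , F′⊆E ∘ α⊆F′ ]′ ∘ ∈-∪⁻) ,
          a , b , separated , joins-self G , joins-mono G F⊆γ∪α f-joins) ,
        λ g∈β → let g∈F′ , smoot = ∈β⁻ g∈β in
          F′⊆E g∈F′ ,
          ([ β∩F≡∅ g∈β ∘ p∩q⊆p F (∁ F′) , (λ g∈α → α∌β g∈α g∈β) ]′ ∘ ∈-∪⁻) ,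
          a , b , separated , joins-self G , joins-mono G F⊆γ∪α f-joins ,
          joins-mono G F⊆γ∪α (smoot-joins smoot)
        where
        α⊆F′ : α ⊆ F′
        α⊆F′ = p∩q⊆p F′ (∁ β) ∘ α⊆D
        α∌β : ∀ {g} → g Subset.∈ α → ¬ g Subset.∈ β
        α∌β g∈α = x∈∁p⇒x∉p (p∩q⊆q F′ (∁ β) (α⊆D g∈α))
        F⊆γ∪α : F ⊆ γ ∪ α
        F⊆γ∪α {g} g∈F = x∈p∪q⁺ (Sum.map₂ F∩F′⊆α (∈-∪⁻ (subst (g Subset.∈_) (sym (p∩∁q∪p∩q≡p F F′)) g∈F)))

      Touches : Fin m → Set
      Touches g = Conn ends F (end₁ G g) a ⊎ Conn ends F (end₂ G g) a

      touches? : Decidable Touches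
      touches? g = conn? ends F (end₁ G g) a ⊎-dec conn? ends F (end₂ G g) a

      -- Adding to F the edges at the component of a leaves the component of b
      -- unchanged, since none of them is a smoot; adding the other edges leaves
      -- the component of a unchanged.
      twin₁? : Decidable (λ g → g Subset.∈ D × (g Subset.∈ F ⊎ Touches g))
      twin₁? g = (g ∈? D) ×-dec ((g ∈? F) ⊎-dec touches? g)

      twin₂? : Decidable (λ g → g Subset.∈ D × (g Subset.∈ F ⊎ ¬ Touches g))
      twin₂? g = (g ∈? D) ×-dec ((g ∈? F) ⊎-dec ¬? (touches? g))

      twin₁ twin₂ : Subset m
      twin₁ = select twin₁?
      twin₂ = select twin₂?

      F-invariant : ∀ {g w} → g Subset.∈ F →
        (Conn ends F (end₁ G g) w → Conn ends F (end₂ G g) w) ×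
        (Conn ends F (end₂ G g) w → Conn ends F (end₁ G g) w)
      F-invariant g∈F = (conn-sym G (conn-edge G g∈F) ◅◅_) , (conn-edge G g∈F ◅◅_)

      twin₁-separated : ¬ Conn ends (γ ∪ twin₁) a b
      -- The invariant is membership in the `F`-component of `b`, so the walk is reversed to start
      -- at `b`.
      twin₁-separated p = a≁b (conn-invariant G {P = λ w → Conn ends F w b} inv (conn-sym G p) ε)
        where
        avoids : ∀ {g} → g Subset.∈ D → ¬ g Subset.∈ F → Touches g →
                 ¬ Conn ends F (end₁ G g) b × ¬ Conn ends F (end₂ G g) b
        -- The end in the component of `a` cannot also be in that of `b`; if the other end were, `g`
        -- would join the two.
        avoids g∈D g∉F (inj₁ t) = 
          (λ q → a≁b (conn-sym G t ◅◅ q)) , (λ q → D─F-¬joins g∈D g∉F (inj₁ (t , q)))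
        avoids g∈D g∉F (inj₂ t) = 
          (λ q → D─F-¬joins g∈D g∉F (inj₂ (q , t))) , (λ q → a≁b (conn-sym G t ◅◅ q))
        inv : ∀ {g} → g Subset.∈ γ ∪ twin₁ → _
        inv {g} g∈ with g ∈? F | ∈-∪⁻ g∈
        ... | yes g∈F | _         = F-invariant g∈F
        ... | no  g∉F | inj₁ g∈γ  = contradiction (p∩q⊆p F (∁ F′) g∈γ) g∉F
        ... | no  g∉F | inj₂ g∈₁ with ∈-select⁻ twin₁? g∈₁
        ...   | g∈D , inj₁ g∈F = contradiction g∈F g∉F
        ...   | g∈D , inj₂ t   with avoids g∈D g∉F t
        ...     | ¬₁ , ¬₂ = (λ q → contradiction q ¬₁) , (λ q → contradiction q ¬₂)

      twin₂-separated : ¬ Conn ends (γ ∪ twin₂) a b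
      twin₂-separated p = a≁b (conn-sym G (conn-invariant G {P = λ w → Conn ends F w a} inv p ε))
        where
        inv : ∀ {g} → g Subset.∈ γ ∪ twin₂ → _
        inv {g} g∈ with g ∈? F | ∈-∪⁻ g∈
        ... | yes g∈F | _         = F-invariant g∈F
        ... | no  g∉F | inj₁ g∈γ  = contradiction (p∩q⊆p F (∁ F′) g∈γ) g∉F
        ... | no  g∉F | inj₂ g∈₂ with ∈-select⁻ twin₂? g∈₂
        ...   | _ , inj₁ g∈F = contradiction g∈F g∉F
        ...   | _ , inj₂ ¬t  = (λ q → contradiction (inj₁ q) ¬t) , (λ q → contradiction (inj₂ q) ¬t)

      F∩F′⊆twin₁ : F ∩ F′ ⊆ twin₁
      F∩F′⊆twin₁ g∈ = ∈-select⁺ twin₁? (F∩F′⊆D g∈ , inj₁ (p∩q⊆p F F′ g∈))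

      F∩F′⊆twin₂ : F ∩ F′ ⊆ twin₂
      F∩F′⊆twin₂ g∈ = ∈-select⁺ twin₂? (F∩F′⊆D g∈ , inj₁ (p∩q⊆p F F′ g∈))

      twin₁∩twin₂≡F∩F′ : twin₁ ∩ twin₂ ≡ F ∩ F′
      twin₁∩twin₂≡F∩F′ = ⊆-antisym common λ g∈ → x∈p∩q⁺ (F∩F′⊆twin₁ g∈ , F∩F′⊆twin₂ g∈)
        where
        common : twin₁ ∩ twin₂ ⊆ F ∩ F′
        common g∈ with ∈-select⁻ twin₁? (p∩q⊆p twin₁ twin₂ g∈) | ∈-select⁻ twin₂? (p∩q⊆q twin₁ twin₂ g∈)
        ... | g∈D , inj₁ g∈F | _               = x∈p∩q⁺ (g∈F , p∩q⊆p F′ (∁ β) g∈D)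
        ... | g∈D , inj₂ _   | _ , inj₁ g∈F    = x∈p∩q⁺ (g∈F , p∩q⊆p F′ (∁ β) g∈D)
        ... | _   , inj₂ t   | _ , inj₂ ¬t     = contradiction t ¬t

      twin₁∪twin₂≡D : twin₁ ∪ twin₂ ≡ D
      twin₁∪twin₂≡D = ⊆-antisym
        ([ proj₁ ∘ ∈-select⁻ twin₁? , proj₁ ∘ ∈-select⁻ twin₂? ]′ ∘ ∈-∪⁻) covered
        where
        covered : D ⊆ twin₁ ∪ twin₂
        covered {g} g∈D with touches? g
        ... | yes t = x∈p∪q⁺ (inj₁ (∈-select⁺ twin₁? (g∈D , inj₂ t)))
        ... | no ¬t = x∈p∪q⁺ (inj₂ (∈-select⁺ twin₂? (g∈D , inj₂ ¬t)))

      twins : Twins G e f β γ twin₁ twin₂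
      twins =
        compatible F∩F′⊆twin₁ (proj₁ ∘ ∈-select⁻ twin₁?) twin₁-separated ,
        compatible F∩F′⊆twin₂ (proj₁ ∘ ∈-select⁻ twin₂?) twin₂-separated ,
        -- For the intersection of the twins, `γ ∪ (F ∩ F′)` is `F` itself, which separates `a` from
        -- `b` as a paracel.
        subst (Compatible G e f β γ) (sym twin₁∩twin₂≡F∩F′)
          (compatible (λ g∈ → g∈) F∩F′⊆D
            (subst (λ H → ¬ Conn ends H a b) (sym (p∩∁q∪p∩q≡p F F′)) a≁b))

    splitPair-∈ : splitPair (F , F′) ∈ twinTriples
    splitPair-∈ = subst (λ μ → ((β , γ) , μ) ∈ twinTriples) monomial
      (∈-twinTriples⁺ (F′⊆E ∘ β⊆F′) (F⊆E ∘ p∩q⊆p F (∁ F′))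
        (λ (_ , g∈) → let g∈β , g∈γ = ∈-∩⁻ g∈ in β∩F≡∅ g∈β (p∩q⊆p F (∁ F′) g∈γ))
        twins)
      where
      monomial : (𝐱^ twin₁) *ᴹ (𝐱^ twin₂) ≡ (𝐱^ (F ∩ F′)) *ᴹ (𝐱^ D)
      monomial = trans (𝐱^-∩-∪ twin₁ twin₂)
        (cong₂ (λ p q → (𝐱^ p) *ᴹ (𝐱^ q)) twin₁∩twin₂≡F∩F′ twin₁∪twin₂≡D)

    -- Because `F ∩ F′ ⊆ D`, the exponents of the monomial give back `F ∩ F′` as intersection and
    -- `D` as union.
    mergePair∘splitPair : mergePair (splitPair (F , F′)) ≡ (F , F′)
    mergePair∘splitPair = cong₂ _,_
      (begin
        γ ∪ support≥ 2 ((𝐱^ (F ∩ F′)) *ᴹ (𝐱^ D))  ≡⟨ cong (γ ∪_) (support≥2-𝐱𝐱 (F ∩ F′) D) ⟩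
        γ ∪ ((F ∩ F′) ∩ D)
          ≡⟨ cong (γ ∪_) (⊆-antisym (p∩q⊆p (F ∩ F′) D) λ g∈ → x∈p∩q⁺ (g∈ , F∩F′⊆D g∈)) ⟩
        γ ∪ (F ∩ F′)                              ≡⟨ p∩∁q∪p∩q≡p F F′ ⟩
        F                                         ∎)
      (begin
        β ∪ support≥ 1 ((𝐱^ (F ∩ F′)) *ᴹ (𝐱^ D))  ≡⟨ cong (β ∪_) (support≥1-𝐱𝐱 (F ∩ F′) D) ⟩
        β ∪ ((F ∩ F′) ∪ D)
          ≡⟨ cong (β ∪_) (⊆-antisym ([ F∩F′⊆D , (λ g∈ → g∈) ]′ ∘ ∈-∪⁻) (q⊆p∪q (F ∩ F′) D)) ⟩
        β ∪ D                                     ≡⟨ q⊆p⇒q∪p∩∁q≡p F′ β β⊆F′ ⟩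
        F′                                        ∎)
      where open ≡-Reasoning

    -- Both sets are split disjointly: `F′` into `β` and `D`, and `F` into `γ` and `F ∩ F′`.
    splitPair-monomial : let ((β , γ) , μ) = splitPair (F , F′) in
      (𝐱^ F) *ᴹ (𝐱^ F′) ≡ ((𝐱^ β) *ᴹ (𝐱^ γ)) *ᴹ μ
    splitPair-monomial = begin
      (𝐱^ F) *ᴹ (𝐱^ F′)
        ≡⟨ *ᴹ-comm (𝐱^ F) (𝐱^ F′) ⟩
      (𝐱^ F′) *ᴹ (𝐱^ F)
        ≡⟨ cong₂ (λ p q → (𝐱^ p) *ᴹ (𝐱^ q)) (q⊆p⇒q∪p∩∁q≡p F′ β β⊆F′) (p∩∁q∪p∩q≡p F F′) ⟨
      (𝐱^ (β ∪ D)) *ᴹ (𝐱^ (γ ∪ (F ∩ F′)))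
        ≡⟨ cong₂ _*ᴹ_ (𝐱^-∪ β D β∩D≡∅) (𝐱^-∪ γ (F ∩ F′) γ∩F∩F′≡∅) ⟩
      ((𝐱^ β) *ᴹ (𝐱^ D)) *ᴹ ((𝐱^ γ) *ᴹ (𝐱^ (F ∩ F′)))
        ≡⟨ *ᴹ-interchange (𝐱^ β) (𝐱^ D) (𝐱^ γ) (𝐱^ (F ∩ F′)) ⟩
      ((𝐱^ β) *ᴹ (𝐱^ γ)) *ᴹ ((𝐱^ D) *ᴹ (𝐱^ (F ∩ F′)))
        ≡⟨ cong (((𝐱^ β) *ᴹ (𝐱^ γ)) *ᴹ_) (*ᴹ-comm (𝐱^ D) (𝐱^ (F ∩ F′))) ⟩
      ((𝐱^ β) *ᴹ (𝐱^ γ)) *ᴹ ((𝐱^ (F ∩ F′)) *ᴹ (𝐱^ D))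
        ∎
      where
      open ≡-Reasoning
      β∩D≡∅ : Empty (β ∩ D)
      β∩D≡∅ (_ , g∈) = let g∈β , g∈D = ∈-∩⁻ g∈ in x∈∁p⇒x∉p (p∩q⊆q F′ (∁ β) g∈D) g∈β
      γ∩F∩F′≡∅ : Empty (γ ∩ (F ∩ F′))
      γ∩F∩F′≡∅ (_ , g∈) = let g∈γ , g∈F∩F′ = ∈-∩⁻ g∈ in
        x∈∁p⇒x∉p (p∩q⊆q F (∁ F′) g∈γ) (p∩q⊆q F F′ g∈F∩F′)

  -- Only the intersection and the union of the twins survive. Different twins with the same product
  -- give the same pair, which is why each monomial of B must be counted once.
  mergePair-twins : ∀ {β γ} α α′ →
    mergePair ((β , γ) , (𝐱^ α) *ᴹ (𝐱^ α′)) ≡ (γ ∪ (α ∩ α′) , β ∪ (α ∪ α′))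
  mergePair-twins α α′ = cong₂ (λ p q → _ ∪ p , _ ∪ q) (support≥2-𝐱𝐱 α α′) (support≥1-𝐱𝐱 α α′)

  -- From twins back to a paracel pair

  module _ {β γ α α′ : Subset m}
           (β⊆E : β ⊆ E) (β∩γ≡∅ : Empty (β ∩ γ)) (twins : Twins G e f β γ α α′) where

    private
      F F′ : Subset m
      F  = γ ∪ (α ∩ α′)
      F′ = β ∪ (α ∪ α′)

      empty : ∀ {p q : Subset m} {g} → Empty (p ∩ q) → g Subset.∈ p → ¬ g Subset.∈ q
      empty p∩q≡∅ g∈p g∈q = p∩q≡∅ (_ , x∈p∩q⁺ (g∈p , g∈q))

      α∪α′-avoids : ∀ {p} → Empty (α ∩ p) → Empty (α′ ∩ p) → ∀ {g} → g Subset.∈ α ∪ α′ → ¬ g Subset.∈ p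
      α∪α′-avoids α∩p≡∅ α′∩p≡∅ g∈ = [ empty α∩p≡∅ , empty α′∩p≡∅ ]′ (∈-∪⁻ g∈)

      avoids-β : ∀ {g} → g Subset.∈ α ∪ α′ → ¬ g Subset.∈ β
      avoids-β = let (_ , αβ , _) , (_ , α′β , _) , _ = twins in α∪α′-avoids αβ α′β

      avoids-γ : ∀ {g} → g Subset.∈ α ∪ α′ → ¬ g Subset.∈ γ
      avoids-γ = let (_ , _ , αγ , _) , (_ , _ , α′γ , _) , _ = twins in α∪α′-avoids αγ α′γ

      ∩⊆∪ : α ∩ α′ ⊆ α ∪ α′
      ∩⊆∪ = p⊆p∪q α′ ∘ p∩q⊆p α α′

      -- A smoot of `F` contained in `α` would connect the ends of `e` in `γ ∪ α`, contradicting
      -- that this is a paracel. Hence no edge of either twin is counted among the smoots of `F`.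
      compatible-¬smoot : ∀ {α g} → F ⊆ γ ∪ α → Compatible G e f β γ α → g Subset.∈ α → ¬ Smoot G e f F g
      compatible-¬smoot {α} F⊆γ∪α (_ , _ , _ , paracel , _) g∈α smoot =
        proj₁ (paracel-ends G e f paracel)
          (joins⇒conn G (q⊆p∪q γ α g∈α) (joins-mono G F⊆γ∪α (smoot-joins smoot)))

      smootsIn≡β : smootsIn F F′ ≡ β
      smootsIn≡β = ⊆-antisym only all
        where
        all : β ⊆ smootsIn F F′
        -- The smoots come from the compatibility of `α ∩ α′`, whose union with `γ` is `F`.
        all g∈β = let _ , _ , (_ , _ , _ , _ , smoots) = twins in
          ∈-select⁺ (smootIn? F F′) (p⊆p∪q (α ∪ α′) g∈β , smoots g∈β)
        only : smootsIn F F′ ⊆ β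
        only g∈ with ∈-select⁻ (smootIn? F F′) g∈
        ... | g∈F′ , smoot with ∈-∪⁻ g∈F′
        ...   | inj₁ g∈β = g∈β
        ...   | inj₂ g∈α∪α′ with ∈-∪⁻ g∈α∪α′
        ...     | inj₁ g∈α  = contradiction smoot
          (compatible-¬smoot (x∈p∪q⁺ ∘ Sum.map₂ (p∩q⊆p α α′) ∘ ∈-∪⁻) (proj₁ twins) g∈α)
        ...     | inj₂ g∈α′ = contradiction smoot
          (compatible-¬smoot (x∈p∪q⁺ ∘ Sum.map₂ (p∩q⊆q α α′) ∘ ∈-∪⁻) (proj₁ (proj₂ twins)) g∈α′)

      F∩∁F′≡γ : F ∩ ∁ F′ ≡ γ
      F∩∁F′≡γ = ⊆-antisym
        (λ g∈ → let g∈F , g∈∁F′ = ∈-∩⁻ g∈ in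
          [ (λ g∈γ → g∈γ)
          , (λ g∈∩ → contradiction (q⊆p∪q β (α ∪ α′) (∩⊆∪ g∈∩)) (x∈∁p⇒x∉p g∈∁F′)) ]′ (∈-∪⁻ g∈F))
        λ g∈γ → x∈p∩q⁺ (p⊆p∪q (α ∩ α′) g∈γ , x∉p⇒x∈∁p
          ([ (λ g∈β → empty β∩γ≡∅ g∈β g∈γ) , (λ g∈ → avoids-γ g∈ g∈γ) ]′ ∘ ∈-∪⁻))

      F∩F′≡α∩α′ : F ∩ F′ ≡ α ∩ α′
      F∩F′≡α∩α′ = ⊆-antisym
        (λ g∈ → let g∈F , g∈F′ = ∈-∩⁻ g∈ in
          [ (λ g∈γ → contradiction g∈γ ([ empty β∩γ≡∅ , avoids-γ ]′ (∈-∪⁻ g∈F′)))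
          , (λ g∈∩ → g∈∩) ]′ (∈-∪⁻ g∈F))
        λ g∈ → x∈p∩q⁺ (q⊆p∪q γ (α ∩ α′) g∈ , q⊆p∪q β (α ∪ α′) (∩⊆∪ g∈))

      F′∩∁β≡α∪α′ : F′ ∩ ∁ β ≡ α ∪ α′
      F′∩∁β≡α∪α′ = ⊆-antisym
        (λ g∈ → let g∈F′ , g∈∁β = ∈-∩⁻ g∈ in
          [ (λ g∈β → contradiction g∈β (x∈∁p⇒x∉p g∈∁β)) , (λ g∈∪ → g∈∪) ]′ (∈-∪⁻ g∈F′))
        λ g∈ → x∈p∩q⁺ (q⊆p∪q β (α ∪ α′) g∈ , x∉p⇒x∈∁p (avoids-β g∈))

    mergePair-∈ : (γ ∪ (α ∩ α′) , β ∪ (α ∪ α′)) ∈ paracelPairs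
    mergePair-∈ = let (α⊆E , _) , (α′⊆E , _) , (_ , _ , _ , paracel , _) = twins in
      ∈-paracelPairs⁺ paracel ([ β⊆E , [ α⊆E , α′⊆E ]′ ∘ ∈-∪⁻ ]′ ∘ ∈-∪⁻)

    splitPair∘mergePair : splitPair (γ ∪ (α ∩ α′) , β ∪ (α ∪ α′)) ≡ ((β , γ) , (𝐱^ α) *ᴹ (𝐱^ α′))
    splitPair∘mergePair = cong₂ _,_ (cong₂ _,_ smootsIn≡β F∩∁F′≡γ) (begin
      (𝐱^ (F ∩ F′)) *ᴹ (𝐱^ (F′ ∩ ∁ (smootsIn F F′)))
        ≡⟨ cong₂ (λ p q → (𝐱^ p) *ᴹ (𝐱^ (F′ ∩ ∁ q))) F∩F′≡α∩α′ smootsIn≡β ⟩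
      (𝐱^ (α ∩ α′)) *ᴹ (𝐱^ (F′ ∩ ∁ β))
        ≡⟨ cong (λ q → (𝐱^ (α ∩ α′)) *ᴹ (𝐱^ q)) F′∩∁β≡α∪α′ ⟩
      (𝐱^ (α ∩ α′)) *ᴹ (𝐱^ (α ∪ α′))
        ≡⟨ 𝐱^-∩-∪ α α′ ⟨
      (𝐱^ α) *ᴹ (𝐱^ α′) ∎)
      where open ≡-Reasoning

  ∑ᶻ-paracelPairs : ∀ (φ : Mon m → ℤ) →
    ∑[ (F , F′) ← paracelPairs ] φ ((𝐱^ F) *ᴹ (𝐱^ F′))
      ≡ ∑[ ((β , γ) , μ) ← twinTriples ] φ (((𝐱^ β) *ᴹ (𝐱^ γ)) *ᴹ μ)
  ∑ᶻ-paracelPairs φ = ∑ᶻ-reindex splitPair mergePair paracelPairs-! twinTriples-! to from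
    (λ FF′∈ → let paracel , F′⊆E = ∈-paracelPairs⁻ FF′∈ in cong φ (splitPair-monomial paracel F′⊆E))
    where
    subsetsOfE-! : Unique (subsetsOf E)
    subsetsOfE-! = Unique.filter⁺ (_⊆? E) (subsets-! m)
    paracelPairs-! : Unique paracelPairs
    paracelPairs-! = Unique.cartesianProduct⁺ (Unique.filter⁺ (paracel? G e f) subsetsOfE-!) subsetsOfE-!
    twinTriples-! : Unique twinTriples
    twinTriples-! = dependentPairs-!
      (Unique.filter⁺ disjoint? (Unique.cartesianProduct⁺ (subsets-! m) (subsets-! m)))
      (λ _ → DecPropositional.deduplicate-! _≟ᴹ_ _)
    to : ∀ {p} → p ∈ paracelPairs → splitPair p ∈ twinTriples × mergePair (splitPair p) ≡ p
    to p∈ = let paracel , F′⊆E = ∈-paracelPairs⁻ p∈ in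
      splitPair-∈ paracel F′⊆E , mergePair∘splitPair paracel F′⊆E
    from : ∀ {t} → t ∈ twinTriples → mergePair t ∈ paracelPairs × splitPair (mergePair t) ≡ t
    from t∈ with ∈-twinTriples⁻ t∈
    ... | (β⊆E , _ , β∩γ≡∅) , α , α′ , refl , twins =
      subst (λ p → p ∈ paracelPairs × splitPair p ≡ (_ , (𝐱^ α) *ᴹ (𝐱^ α′))) (sym (mergePair-twins α α′))
        (mergePair-∈ β⊆E β∩γ≡∅ twins , splitPair∘mergePair β⊆E β∩γ≡∅ twins)

-- Evaluation of ℳ at q = 1

-- The polynomial 𝐱^b (1 + q + ... + q^(N-1)), that is, 𝐱^b (1 - q^N) / (1 - q).
geometric : ∀ {m} → ℕ → Mon m → Poly (suc m)
geometric zero    b = []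
geometric (suc N) b = (1ℤ , N ∷ b) ∷ geometric N b

-- The functional on the left is multiplication by 𝐱^a (1 - q) followed by `ψ`, so the sum
-- telescopes.
eval-geometric : ∀ {m} N (a b : Mon m) (ψ : Mon (suc m) → ℤ) →
  eval (geometric N b) (λ c → ψ ((0 ∷ a) *ᴹ c) - ψ ((1 ∷ a) *ᴹ c))
    ≡ ψ (0 ∷ (a *ᴹ b)) - ψ (N ∷ (a *ᴹ b))
eval-geometric zero    a b ψ = sym (ℤ.+-inverseʳ (ψ (0 ∷ (a *ᴹ b))))
eval-geometric (suc N) a b ψ =
  trans (cong (λ s → 1ℤ * (ψ (N ∷ (a *ᴹ b)) - ψ (suc N ∷ (a *ᴹ b))) + s) (eval-geometric N a b ψ))
    (telescope (ψ (N ∷ (a *ᴹ b))) (ψ (suc N ∷ (a *ᴹ b))) (ψ (0 ∷ (a *ᴹ b))))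
  where
  telescope : ∀ x y z → 1ℤ * (x - y) + (z - x) ≡ z - y
  telescope = solve-∀

module _ {n m : ℕ} (G : Graph n m) where

  eval-𝒯 : ∀ {A B} ψ → Empty (A ∩ B) →
    eval (𝒯 G A B) ψ ≡ ∑[ F ← subsetsOf (∁ (A ∪ B)) ] ψ (k G (F ∪ A) ∷ ((𝐱^ A) *ᴹ (𝐱^ F)))
  eval-𝒯 {A} {B} ψ A∩B≡∅ = begin
    eval (𝒯 G A B) ψ
      ≡⟨ eval-∑ between (λ F → mono (k G F ∷ (𝐱^ F))) ψ ⟩
    ∑[ F ← between ] eval (mono (k G F ∷ (𝐱^ F))) ψ
      ≡⟨ ∑ᶻ-cong between (λ F → eval-mono (k G F ∷ (𝐱^ F)) ψ) ⟩
    ∑[ F ← between ] ψ (k G F ∷ (𝐱^ F))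
      ≡⟨ ∑ᶻ-between A B A∩B≡∅ ⟩
    ∑[ F ← subsetsOf (∁ (A ∪ B)) ] ψ (k G (F ∪ A) ∷ (𝐱^ (F ∪ A)))
      ≡⟨ ∑ᶻ-cong-∈ (subsetsOf (∁ (A ∪ B))) (λ {F} F∈ → cong (λ a → ψ (k G (F ∪ A) ∷ a))
           (trans (𝐱^-∪ F A (F∩A≡∅ F∈)) (*ᴹ-comm (𝐱^ F) (𝐱^ A)))) ⟩
    ∑[ F ← subsetsOf (∁ (A ∪ B)) ] ψ (k G (F ∪ A) ∷ ((𝐱^ A) *ᴹ (𝐱^ F)))
      ∎
    where
    open ≡-Reasoning
    between = filter (λ F → (A ⊆? F) ×-dec ¬? (nonempty? (F ∩ B))) (subsets m)
    F∩A≡∅ : ∀ {F} → F ∈ subsetsOf (∁ (A ∪ B)) → Empty (F ∩ A)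
    F∩A≡∅ F∈ (_ , g∈) with ∈-∩⁻ g∈ | ∈-filter⁻ (_⊆? ∁ (A ∪ B)) {xs = subsets m} F∈
    ... | g∈F , g∈A | _ , F⊆ = x∈∁p⇒x∉p (F⊆ g∈F) (p⊆p∪q B g∈A)

  -- The common set `S` lets the two products of the numerator, whose unions are written
  -- differently, be summed over the same pairs.
  eval-𝒯*𝒯 : ∀ {A B C D S} ψ → Empty (A ∩ B) → Empty (C ∩ D) → A ∪ B ≡ S → C ∪ D ≡ S →
    eval (𝒯 G A B *ᴾ 𝒯 G C D) ψ
      ≡ ∑[ F ← subsetsOf (∁ S) ] ∑[ F′ ← subsetsOf (∁ S) ]
          ψ ((k G (F ∪ A) ℕ.+ k G (F′ ∪ C)) ∷ (((𝐱^ A) *ᴹ (𝐱^ C)) *ᴹ ((𝐱^ F) *ᴹ (𝐱^ F′))))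
  eval-𝒯*𝒯 {A} {B} {C} {D} {S} ψ A∩B≡∅ C∩D≡∅ refl C∪D≡S = begin
    eval (𝒯 G A B *ᴾ 𝒯 G C D) ψ
      ≡⟨ eval-* (𝒯 G A B) (𝒯 G C D) ψ ⟩
    eval (𝒯 G A B) (λ a → eval (𝒯 G C D) (λ b → ψ (a *ᴹ b)))
      ≡⟨ eval-𝒯 _ A∩B≡∅ ⟩
    ∑[ F ← subsetsOf (∁ S) ] eval (𝒯 G C D) (λ b → ψ ((k G (F ∪ A) ∷ ((𝐱^ A) *ᴹ (𝐱^ F))) *ᴹ b))
      ≡⟨ ∑ᶻ-cong (subsetsOf (∁ S)) inner ⟩
    ∑[ F ← subsetsOf (∁ S) ] ∑[ F′ ← subsetsOf (∁ S) ]
      ψ ((k G (F ∪ A) ℕ.+ k G (F′ ∪ C)) ∷ (((𝐱^ A) *ᴹ (𝐱^ C)) *ᴹ ((𝐱^ F) *ᴹ (𝐱^ F′))))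
      ∎
    where
    open ≡-Reasoning
    inner : ∀ F →
      eval (𝒯 G C D) (λ b → ψ ((k G (F ∪ A) ∷ ((𝐱^ A) *ᴹ (𝐱^ F))) *ᴹ b))
        ≡ ∑[ F′ ← subsetsOf (∁ S) ]
            ψ ((k G (F ∪ A) ℕ.+ k G (F′ ∪ C)) ∷ (((𝐱^ A) *ᴹ (𝐱^ C)) *ᴹ ((𝐱^ F) *ᴹ (𝐱^ F′))))
    inner F = trans (eval-𝒯 _ C∩D≡∅) (trans
      (∑ᶻ-cong (subsetsOf (∁ (C ∪ D))) λ F′ →
        cong (λ a → ψ ((k G (F ∪ A) ℕ.+ k G (F′ ∪ C)) ∷ a))
          (*ᴹ-interchange (𝐱^ A) (𝐱^ F) (𝐱^ C) (𝐱^ F′)))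
      (cong (λ T → ∑[ F′ ← subsetsOf (∁ T) ]
        ψ ((k G (F ∪ A) ℕ.+ k G (F′ ∪ C)) ∷ (((𝐱^ A) *ᴹ (𝐱^ C)) *ᴹ ((𝐱^ F) *ᴹ (𝐱^ F′))))) C∪D≡S))

  module _ (e f : Fin m) where

    private
      ef : Subset m
      ef = ⁅ e ⁆ ∪ ⁅ f ⁆
      𝐱ᵉᶠ : Mon m
      𝐱ᵉᶠ = (𝐱^ ⁅ e ⁆) *ᴹ (𝐱^ ⁅ f ⁆)
      R : List (Subset m)
      R = subsetsOf (Eᵉᶠ G e f)

      k⁰ kᵉ kᶠ kᵉᶠ : Subset m → ℕ
      k⁰  F = k G F
      kᵉ  F = k G (F ∪ ⁅ e ⁆)
      kᶠ  F = k G (F ∪ ⁅ f ⁆)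
      kᵉᶠ F = k G (F ∪ ef)

      -- The value at q = 1 of (q^A - q^B) / (1 - q), with A = `kᵉ F + kᶠ F′` and B =
      -- `kᵉᶠ F + k⁰ F′`.
      excess : Subset m → Subset m → ℤ
      excess F F′ = (ℤ.+ kᵉᶠ F + ℤ.+ k⁰ F′) - (ℤ.+ kᵉ F + ℤ.+ kᶠ F′)

    divisor numerator : Poly (suc m)
    divisor   = 𝐱 e *ᴾ 𝐱 f *ᴾ (1ᴾ -ᴾ 𝐪)
    numerator = 𝒯 G ⁅ e ⁆ ⁅ f ⁆ *ᴾ 𝒯 G ⁅ f ⁆ ⁅ e ⁆ -ᴾ 𝒯 G ef ⊥ *ᴾ 𝒯 G ⊥ ef

    eval-divisor : ∀ ℳ ψ →
      eval (divisor *ᴾ ℳ) ψ ≡ eval ℳ (λ c → ψ ((0 ∷ 𝐱ᵉᶠ) *ᴹ c) - ψ ((1 ∷ 𝐱ᵉᶠ) *ᴹ c))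
    eval-divisor ℳ ψ = begin
      eval (divisor *ᴾ ℳ) ψ
        ≡⟨ eval-* divisor ℳ ψ ⟩
      eval divisor χ
        -- Multiplied out, the divisor has the two terms x_e x_f and -q x_e x_f; `𝟎` is what the
        -- factors 1 and q contribute to the other exponents.
        ≡⟨ two-terms (χ (0 ∷ (𝐱ᵉᶠ *ᴹ 𝟎))) (χ (1 ∷ (𝐱ᵉᶠ *ᴹ 𝟎))) ⟩
      χ (0 ∷ (𝐱ᵉᶠ *ᴹ 𝟎)) - χ (1 ∷ (𝐱ᵉᶠ *ᴹ 𝟎))
        ≡⟨ cong (λ a → χ (0 ∷ a) - χ (1 ∷ a)) (*ᴹ-identityʳ 𝐱ᵉᶠ) ⟩
      χ (0 ∷ 𝐱ᵉᶠ) - χ (1 ∷ 𝐱ᵉᶠ)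
        ≡⟨ ∑ᶻ-- ℳ ⟨
      ∑[ (d , c) ← ℳ ] (d * ψ ((0 ∷ 𝐱ᵉᶠ) *ᴹ c) - d * ψ ((1 ∷ 𝐱ᵉᶠ) *ᴹ c))
        ≡⟨ ∑ᶻ-cong ℳ (λ (d , c) → factor d (ψ ((0 ∷ 𝐱ᵉᶠ) *ᴹ c)) (ψ ((1 ∷ 𝐱ᵉᶠ) *ᴹ c))) ⟩
      eval ℳ (λ c → ψ ((0 ∷ 𝐱ᵉᶠ) *ᴹ c) - ψ ((1 ∷ 𝐱ᵉᶠ) *ᴹ c))
        ∎
      where
      open ≡-Reasoning
      𝟎 : Mon m
      𝟎 = Vec.replicate m 0
      χ : Mon (suc m) → ℤ
      χ a = eval ℳ (λ c → ψ (a *ᴹ c))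
      two-terms : ∀ x y → 1ℤ * x + (- 1ℤ * y + 0ℤ) ≡ x - y
      two-terms = solve-∀
      factor : ∀ d x y → d * x - d * y ≡ d * (x - y)
      factor = solve-∀

    -- Differentiate in q at q = 1, divide by x_e x_f and apply φ: x_e x_f (1 − q) ℳ is
    -- sent to − φ(ℳ(1)), which yields ℳ(1) without cancelling in the polynomial ring.
    derivative : (Mon m → ℤ) → Mon (suc m) → ℤ
    derivative φ c = ℤ.+ Vec.head c * φ (Vec.tail c /ᴹ 𝐱ᵉᶠ)

    derivative-cons : ∀ φ i b → derivative φ (i ∷ (𝐱ᵉᶠ *ᴹ b)) ≡ ℤ.+ i * φ b
    derivative-cons φ i b = cong (λ a → ℤ.+ i * φ a) (*ᴹ-/ᴹ-cancelˡ 𝐱ᵉᶠ b)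

    eval-derivative-divisor : ∀ ℳ φ →
      eval (divisor *ᴾ ℳ) (derivative φ) ≡ - eval (at-q=1 ℳ) φ
    eval-derivative-divisor ℳ φ = begin
      eval (divisor *ᴾ ℳ) (derivative φ)      ≡⟨ eval-divisor ℳ (derivative φ) ⟩
      eval ℳ _                                ≡⟨ eval-cong ℳ drop ⟩
      eval ℳ (λ c → - φ (Vec.tail c))         ≡⟨ eval-neg ℳ ⟩
      - eval ℳ (φ ∘ Vec.tail)                 ≡⟨ cong -_ (eval-at-q=1 ℳ φ) ⟨
      - eval (at-q=1 ℳ) φ                     ∎
      where
      open ≡-Reasoning
      drop-one : ∀ i x → i * x - (1ℤ + i) * x ≡ - x
      drop-one = solve-∀
      -- A term q^i of ℳ becomes q^i - q^(i+1), whose derivative at q = 1 is -1 whatever `i` is.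
      drop : ∀ c → derivative φ ((0 ∷ 𝐱ᵉᶠ) *ᴹ c) - derivative φ ((1 ∷ 𝐱ᵉᶠ) *ᴹ c) ≡ - φ (Vec.tail c)
      drop (i ∷ b) = trans (cong₂ _-_ (derivative-cons φ i b) (derivative-cons φ (suc i) b))
        (drop-one (ℤ.+ i) (φ b))

    -- F and F′ play symmetric roles in 𝐱^F 𝐱^F′, so k(F′) − k(F′+f) may be replaced
    -- by k(F) − k(F+f).
    ∑ᶻ-symmetrise : ∀ (φ : Mon m → ℤ) →
      ∑[ F ← R ] ∑[ F′ ← R ] (excess F F′ * φ ((𝐱^ F) *ᴹ (𝐱^ F′)))
        ≡ ∑[ F ← R ] ∑[ F′ ← R ] (excess F F * φ ((𝐱^ F) *ᴹ (𝐱^ F′)))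
    ∑ᶻ-symmetrise φ = begin
      ∑[ F ← R ] ∑[ F′ ← R ] (excess F F′ * w F F′)
        ≡⟨ split (λ F F′ → F′) ⟩
      k-drop + (∑[ F ← R ] ∑[ F′ ← R ] ((ℤ.+ k⁰ F′ - ℤ.+ kᶠ F′) * w F F′))
        ≡⟨ cong (λ s → k-drop + s) (trans (∑ᶻ-swap R R) (∑ᶻ-cong R λ F → ∑ᶻ-cong R λ F′ →
             cong (λ a → (ℤ.+ k⁰ F - ℤ.+ kᶠ F) * φ a) (*ᴹ-comm (𝐱^ F′) (𝐱^ F)))) ⟩
      k-drop + (∑[ F ← R ] ∑[ F′ ← R ] ((ℤ.+ k⁰ F - ℤ.+ kᶠ F) * w F F′))
        ≡⟨ split (λ F F′ → F) ⟨
      ∑[ F ← R ] ∑[ F′ ← R ] (excess F F * w F F′)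
        ∎
      where
      open ≡-Reasoning
      w : Subset m → Subset m → ℤ
      w F F′ = φ ((𝐱^ F) *ᴹ (𝐱^ F′))
      k-drop : ℤ
      k-drop = ∑[ F ← R ] ∑[ F′ ← R ] ((ℤ.+ kᵉᶠ F - ℤ.+ kᵉ F) * w F F′)
      distribute : ∀ x y z u v → ((x + y) - (z + u)) * v ≡ (x - z) * v + (y - u) * v
      distribute = solve-∀
      split : ∀ (H : Subset m → Subset m → Subset m) →
        ∑[ F ← R ] ∑[ F′ ← R ] (excess F (H F F′) * w F F′)
          ≡ k-drop
            + (∑[ F ← R ] ∑[ F′ ← R ] ((ℤ.+ k⁰ (H F F′) - ℤ.+ kᶠ (H F F′)) * w F F′))
      split H = trans
        (∑ᶻ-cong R λ F → trans
          (∑ᶻ-cong R λ F′ → distribute (ℤ.+ kᵉᶠ F) (ℤ.+ k⁰ (H F F′)) (ℤ.+ kᵉ F) (ℤ.+ kᶠ (H F F′)) (w F F′))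
          (∑ᶻ-+ R))
        (∑ᶻ-+ R)

    -- On the diagonal, `excess` depends on `F` alone and leaves the inner sum. By `paracel-nullity`
    -- it is an indicator, so it acts as a filter.
    ∑ᶻ-nullity : ∀ (φ : Mon m → ℤ) →
      ∑[ F ← R ] ∑[ F′ ← R ] (excess F F * φ ((𝐱^ F) *ᴹ (𝐱^ F′)))
        ≡ ∑[ (F , F′) ← paracelPairs G e f ] φ ((𝐱^ F) *ᴹ (𝐱^ F′))
    ∑ᶻ-nullity φ = begin
      ∑[ F ← R ] ∑[ F′ ← R ] (excess F F * w F F′)
        ≡⟨ ∑ᶻ-cong-∈ R (λ {F} F∈ → trans (∑ᶻ-*ˡ R {w F} (excess F F)) (trans
             (cong (_* ∑ᶻ R (w F)) (paracel-nullity G e f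
                 (proj₂ (∈-filter⁻ (_⊆? Eᵉᶠ G e f) {xs = subsets m} F∈))))
             (indicator (does (paracel? G e f F)) (∑ᶻ R (w F))))) ⟩
      ∑[ F ← R ] (if does (paracel? G e f F) then ∑ᶻ R (w F) else 0ℤ)
        ≡⟨ ∑ᶻ-filter (paracel? G e f) R ⟨
      ∑[ F ← filter (paracel? G e f) R ] ∑[ F′ ← R ] w F F′
        ≡⟨ ∑ᶻ-cartesianProduct (filter (paracel? G e f) R) R ⟨
      ∑[ (F , F′) ← paracelPairs G e f ] w F F′
        ∎
      where
      open ≡-Reasoning
      w : Subset m → Subset m → ℤ
      w F F′ = φ ((𝐱^ F) *ᴹ (𝐱^ F′))
      indicator : ∀ b x → (if b then 1ℤ else 0ℤ) * x ≡ (if b then x else 0ℤ)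
      indicator true  x = ℤ.*-identityˡ x
      indicator false x = refl

    twinExpansion : Poly m
    twinExpansion = ∑ (disjointPairs G e f) (λ (β , γ) →
      mono (𝐱^ β) *ᴾ mono (𝐱^ γ) *ᴾ ∑ (twinMonomials G e f β γ) mono)

    eval-twinExpansion : ∀ (φ : Mon m → ℤ) →
      eval twinExpansion φ
        ≡ ∑[ ((β , γ) , μ) ← twinTriples G e f ] φ (((𝐱^ β) *ᴹ (𝐱^ γ)) *ᴹ μ)
    eval-twinExpansion φ = begin
      eval twinExpansion φ
        ≡⟨ eval-∑ (disjointPairs G e f) p φ ⟩
      ∑[ βγ ← disjointPairs G e f ] eval (p βγ) φ
        ≡⟨ ∑ᶻ-cong (disjointPairs G e f) term ⟩
      ∑[ (β , γ) ← disjointPairs G e f ] ∑[ μ ← twinMonomials G e f β γ ] φ (((𝐱^ β) *ᴹ (𝐱^ γ)) *ᴹ μ)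
        ≡⟨ ∑ᶻ-dependentPairs (disjointPairs G e f) ⟨
      ∑[ ((β , γ) , μ) ← twinTriples G e f ] φ (((𝐱^ β) *ᴹ (𝐱^ γ)) *ᴹ μ)
        ∎
      where
      open ≡-Reasoning
      p : Subset m × Subset m → Poly m
      p (β , γ) = mono (𝐱^ β) *ᴾ mono (𝐱^ γ) *ᴾ ∑ (twinMonomials G e f β γ) mono
      term : ∀ ((β , γ) : Subset m × Subset m) →
        eval (p (β , γ)) φ ≡ ∑[ μ ← twinMonomials G e f β γ ] φ (((𝐱^ β) *ᴹ (𝐱^ γ)) *ᴹ μ)
      term (β , γ) = begin
        eval (p (β , γ)) φ
          ≡⟨ eval-* (mono (𝐱^ β) *ᴾ mono (𝐱^ γ)) (∑ (twinMonomials G e f β γ) mono) φ ⟩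
        eval (mono ((𝐱^ β) *ᴹ (𝐱^ γ))) (λ a → eval (∑ (twinMonomials G e f β γ) mono) (λ b → φ (a *ᴹ b)))
          ≡⟨ eval-mono ((𝐱^ β) *ᴹ (𝐱^ γ))
             (λ a → eval (∑ (twinMonomials G e f β γ) mono) (λ b → φ (a *ᴹ b))) ⟩
        eval (∑ (twinMonomials G e f β γ) mono) (λ b → φ (((𝐱^ β) *ᴹ (𝐱^ γ)) *ᴹ b))
          ≡⟨ eval-∑ (twinMonomials G e f β γ) mono _ ⟩
        ∑[ μ ← twinMonomials G e f β γ ] eval (mono μ) (λ b → φ (((𝐱^ β) *ᴹ (𝐱^ γ)) *ᴹ b))
          ≡⟨ ∑ᶻ-cong (twinMonomials G e f β γ) (λ μ → eval-mono μ (λ b → φ (((𝐱^ β) *ᴹ (𝐱^ γ)) *ᴹ b))) ⟩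
        ∑[ μ ← twinMonomials G e f β γ ] φ (((𝐱^ β) *ᴹ (𝐱^ γ)) *ᴹ μ)
          ∎

    -- The numerator and its quotients

    module _ (e≢f : e ≢ f) where

      private
        e∩f≡∅ : Empty (⁅ e ⁆ ∩ ⁅ f ⁆)
        e∩f≡∅ (_ , g∈) with g∈e , g∈f ← ∈-∩⁻ g∈ =
          e≢f (trans (sym (x∈⁅y⁆⇒x≡y e g∈e)) (x∈⁅y⁆⇒x≡y f g∈f))
        f∩e≡∅ : Empty (⁅ f ⁆ ∩ ⁅ e ⁆)
        f∩e≡∅ = subst Empty (∩-comm ⁅ e ⁆ ⁅ f ⁆) e∩f≡∅

      eval-numerator : ∀ ψ → eval numerator ψ ≡
        ∑[ F ← R ] ∑[ F′ ← R ] ( ψ ((kᵉ F ℕ.+ kᶠ F′) ∷ (𝐱ᵉᶠ *ᴹ ((𝐱^ F) *ᴹ (𝐱^ F′))))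
                               - ψ ((kᵉᶠ F ℕ.+ k⁰ F′) ∷ (𝐱ᵉᶠ *ᴹ ((𝐱^ F) *ᴹ (𝐱^ F′)))))
      eval-numerator ψ = begin
        eval numerator ψ
          ≡⟨ eval-- (𝒯 G ⁅ e ⁆ ⁅ f ⁆ *ᴾ 𝒯 G ⁅ f ⁆ ⁅ e ⁆) ⟩
        eval (𝒯 G ⁅ e ⁆ ⁅ f ⁆ *ᴾ 𝒯 G ⁅ f ⁆ ⁅ e ⁆) ψ - eval (𝒯 G ef ⊥ *ᴾ 𝒯 G ⊥ ef) ψ
          ≡⟨ cong₂ _-_ (eval-𝒯*𝒯 ψ e∩f≡∅ f∩e≡∅ refl (∪-comm ⁅ f ⁆ ⁅ e ⁆)) second ⟩
        (∑[ F ← R ] ∑[ F′ ← R ] x F F′) - (∑[ F ← R ] ∑[ F′ ← R ] y F F′)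
          ≡⟨ ∑ᶻ-- R ⟨
        ∑[ F ← R ] ((∑[ F′ ← R ] x F F′) - (∑[ F′ ← R ] y F F′))
          ≡⟨ ∑ᶻ-cong R (λ F → ∑ᶻ-- R) ⟨
        ∑[ F ← R ] ∑[ F′ ← R ] (x F F′ - y F F′)
          ∎
        where
        open ≡-Reasoning
        x y : Subset m → Subset m → ℤ
        x F F′ = ψ ((kᵉ F ℕ.+ kᶠ F′) ∷ (𝐱ᵉᶠ *ᴹ ((𝐱^ F) *ᴹ (𝐱^ F′))))
        y F F′ = ψ ((kᵉᶠ F ℕ.+ k⁰ F′) ∷ (𝐱ᵉᶠ *ᴹ ((𝐱^ F) *ᴹ (𝐱^ F′))))
        monomial : (𝐱^ ef) *ᴹ (𝐱^ (⊥ {m})) ≡ 𝐱ᵉᶠ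
        monomial = trans (cong ((𝐱^ ef) *ᴹ_) 𝐱^⊥)
          (trans (*ᴹ-identityʳ (𝐱^ ef)) (𝐱^-∪ ⁅ e ⁆ ⁅ f ⁆ e∩f≡∅))
        second : eval (𝒯 G ef ⊥ *ᴾ 𝒯 G ⊥ ef) ψ ≡ ∑[ F ← R ] ∑[ F′ ← R ] y F F′
        second = trans
          (eval-𝒯*𝒯 ψ (λ (_ , g∈) → ∉⊥ (p∩q⊆q ef ⊥ g∈)) (λ (_ , g∈) → ∉⊥ (p∩q⊆p ⊥ ef g∈))
            (∪-identityʳ ef) (∪-identityˡ ef))
          (∑ᶻ-cong R λ F → ∑ᶻ-cong R λ F′ →
            cong₂ (λ H a → ψ ((kᵉᶠ F ℕ.+ k G H) ∷ (a *ᴹ ((𝐱^ F) *ᴹ (𝐱^ F′))))) (∪-identityʳ F′) monomial)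

      -- (q^A - q^B) / (1 - q) is written as (1 - q^B) / (1 - q) - (1 - q^A) / (1 - q), which avoids
      -- deciding which exponent is larger.
      quotientTerm : Subset m → Subset m → Poly (suc m)
      quotientTerm F F′ =
        geometric (kᵉᶠ F ℕ.+ k⁰ F′) ((𝐱^ F) *ᴹ (𝐱^ F′))
          -ᴾ geometric (kᵉ F ℕ.+ kᶠ F′) ((𝐱^ F) *ᴹ (𝐱^ F′))

      quotient : Poly (suc m)
      quotient = ∑ R λ F → ∑ R (quotientTerm F)

      quotient-isℳ : Isℳ G e f quotient
      quotient-isℳ = eval⇒≈ᴾ {p = divisor *ᴾ quotient} {r = numerator} λ ψ →
        let χ : Mon (suc m) → ℤ
            χ c = ψ ((0 ∷ 𝐱ᵉᶠ) *ᴹ c) - ψ ((1 ∷ 𝐱ᵉᶠ) *ᴹ c)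
        in begin
        eval (divisor *ᴾ quotient) ψ  ≡⟨ eval-divisor quotient ψ ⟩
        eval quotient χ               ≡⟨ eval-∑ R (λ F → ∑ R (quotientTerm F)) χ ⟩
        ∑[ F ← R ] eval (∑ R (quotientTerm F)) χ
          ≡⟨ ∑ᶻ-cong R (λ F → trans (eval-∑ R (quotientTerm F) χ) (∑ᶻ-cong R (term ψ F))) ⟩
        _                             ≡⟨ eval-numerator ψ ⟨
        eval numerator ψ              ∎
        where
        open ≡-Reasoning
        cancel : ∀ x y z → (x - y) - (x - z) ≡ z - y
        cancel = solve-∀
        term : ∀ (ψ : Mon (suc m) → ℤ) F F′ →
          eval (quotientTerm F F′) (λ c → ψ ((0 ∷ 𝐱ᵉᶠ) *ᴹ c) - ψ ((1 ∷ 𝐱ᵉᶠ) *ᴹ c))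
            ≡ ψ ((kᵉ F ℕ.+ kᶠ F′) ∷ (𝐱ᵉᶠ *ᴹ ((𝐱^ F) *ᴹ (𝐱^ F′))))
              - ψ ((kᵉᶠ F ℕ.+ k⁰ F′) ∷ (𝐱ᵉᶠ *ᴹ ((𝐱^ F) *ᴹ (𝐱^ F′))))
        term ψ F F′ = begin
          eval (geometric M b -ᴾ geometric N b) χ
            ≡⟨ eval-- (geometric M b) ⟩
          eval (geometric M b) χ - eval (geometric N b) χ
            ≡⟨ cong₂ _-_ (eval-geometric M 𝐱ᵉᶠ b ψ) (eval-geometric N 𝐱ᵉᶠ b ψ) ⟩
          (ψ (0 ∷ a) - ψ (M ∷ a)) - (ψ (0 ∷ a) - ψ (N ∷ a))
            ≡⟨ cancel (ψ (0 ∷ a)) (ψ (M ∷ a)) (ψ (N ∷ a)) ⟩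
          ψ (N ∷ a) - ψ (M ∷ a)
            ∎
          where
          M = kᵉᶠ F ℕ.+ k⁰ F′
          N = kᵉ F ℕ.+ kᶠ F′
          b = (𝐱^ F) *ᴹ (𝐱^ F′)
          a = 𝐱ᵉᶠ *ᴹ b
          χ = λ c → ψ ((0 ∷ 𝐱ᵉᶠ) *ᴹ c) - ψ ((1 ∷ 𝐱ᵉᶠ) *ᴹ c)

      -- Only the product of ℳ with the divisor is given, so `derivative φ` is applied to both sides
      -- of that equation. The factor 1 - q has derivative -1, which puts a minus sign on both
      -- results.
      eval-at-q=1-ℳ : ∀ ℳ φ → Isℳ G e f ℳ →
        eval (at-q=1 ℳ) φ ≡ ∑[ F ← R ] ∑[ F′ ← R ]
          (excess F F′ * φ ((𝐱^ F) *ᴹ (𝐱^ F′)))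
      eval-at-q=1-ℳ ℳ φ isℳ = ℤ.neg-injective (begin
        - eval (at-q=1 ℳ) φ
          ≡⟨ eval-derivative-divisor ℳ φ ⟨
        eval (divisor *ᴾ ℳ) (derivative φ)
          ≡⟨ eval-resp-≈ᴾ {p = divisor *ᴾ ℳ} {r = numerator} (derivative φ) isℳ ⟩
        eval numerator (derivative φ)
          ≡⟨ eval-numerator (derivative φ) ⟩
        _
          ≡⟨ ∑ᶻ-cong R (λ F → trans (∑ᶻ-cong R (term F)) (∑ᶻ-neg R)) ⟩
        ∑[ F ← R ] (- (∑[ F′ ← R ] t F F′))
          ≡⟨ ∑ᶻ-neg R ⟩
        - (∑[ F ← R ] ∑[ F′ ← R ] t F F′)
          ∎)
        where
        open ≡-Reasoning
        t : Subset m → Subset m → ℤ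
        t F F′ = excess F F′ * φ ((𝐱^ F) *ᴹ (𝐱^ F′))
        factor : ∀ x y z → x * z - y * z ≡ - ((y - x) * z)
        factor = solve-∀
        term : ∀ F F′ → derivative φ ((kᵉ F ℕ.+ kᶠ F′) ∷ (𝐱ᵉᶠ *ᴹ ((𝐱^ F) *ᴹ (𝐱^ F′))))
          - derivative φ ((kᵉᶠ F ℕ.+ k⁰ F′) ∷ (𝐱ᵉᶠ *ᴹ ((𝐱^ F) *ᴹ (𝐱^ F′)))) ≡ - t F F′
        term F F′ = trans
          (cong₂ _-_ (derivative-cons φ (kᵉ F ℕ.+ kᶠ F′) ((𝐱^ F) *ᴹ (𝐱^ F′)))
                     (derivative-cons φ (kᵉᶠ F ℕ.+ k⁰ F′) ((𝐱^ F) *ᴹ (𝐱^ F′))))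
          (factor (ℤ.+ (kᵉ F ℕ.+ kᶠ F′)) (ℤ.+ (kᵉᶠ F ℕ.+ k⁰ F′)) (φ ((𝐱^ F) *ᴹ (𝐱^ F′))))

theorem3p5 : ∀ {n m : ℕ} (G : Graph n m) (e f : Fin m) → e ≢ f →
    (∃[ ℳ ] Isℳ G e f ℳ) ×
    (∀ (ℳ : Poly (suc m)) → Isℳ G e f ℳ →
    at-q=1 ℳ ≈ᴾ
    ∑ (disjointPairs G e f) (λ (β , γ) →
    mono (𝐱^ β) *ᴾ mono (𝐱^ γ) *ᴾ ∑ (twinMonomials G e f β γ) mono))
theorem3p5 G e f e≢f =
  -- The explicit quotient establishes the divisibility by x_e x_f (1 - q).
  (quotient G e f e≢f , quotient-isℳ G e f e≢f) ,
  λ ℳ isℳ → eval⇒≈ᴾ {p = at-q=1 ℳ} {r = twinExpansion G e f} λ φ →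
    trans (eval-at-q=1-ℳ G e f e≢f ℳ φ isℳ)
    (trans (∑ᶻ-symmetrise G e f φ)
    (trans (∑ᶻ-nullity G e f φ)
    (trans (∑ᶻ-paracelPairs G e f φ)
    (sym (eval-twinExpansion G e f φ)))))
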